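{- Let $m\ge 4$ be even, $n=2^m-1$, let $i_1,i_2\in\{0,1,2,3\}$ with $i_1-i_2\equiv 1\pmod 2$ and $0\notin\{i_1,i_2\}$, let $\mathcal{C}=\mathcal{C}_{i_1,i_2}$ and let $\mathcal{C}^*$ be the extended code of $\mathcal{C}$. Then: (i) $\mathrm{Aut}(\mathcal{C}^*)\cong \mathrm{Aut}(\mathcal{C})\ltimes \mathbb{F}_2^m$ (a semidirect product with normal subgroup isomorphic to $\mathbb{F}_2^m$); (ii) the order of $\mathrm{Aut}(\mathcal{C}^*)$ is \[ (2^m-1)\cdot 2^{m-1}\cdot(2^{m-2}-1)\cdot 2^{m-3}\cdots(2^2-1)\cdot 2\cdot 2^m. \]
   Context: $\mathbb{F}_2$ is the binary field. Let $\alpha$ be a primitive element of $GF(2^m)$ and let $H_m$ be the $m\times n$ binary matrix whose $i$-th column $\mathbf{h}_i$ ($i=0,\dots,n-1$) is the coordinate vector of $\alpha^i$ with respect to the basis $1,\alpha,\dots,\alpha^{m-1}$ (so the columns are exactly the nonzero vectors of $\mathbb{F}_2^m$; $H_m$ is a parity check matrix of the Hamming code). For distinct $i_1,i_2\in\{0,1,2,3\}$, $\mathbf{v}_{i_1,i_2}=(v_0,\dots,v_{n-1})$ has $v_i=1$ iff the Hamming weight $\mathrm{wt}(\mathbf{h}_i)\equiv i_1$ or $i_2\pmod 4$; $\mathcal{C}_{i_1,i_2}$ is the code with parity check matrix $H_m$ with the row $\mathbf{v}_{i_1,i_2}$ appended. The extension of a code $C$ of length $n$ is $C^*=\{(c_\infty,c_0,\dots,c_{n-1}):(c_0,\dots,c_{n-1})\in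 C,\ c_\infty=\sum_i c_i\}$. $\mathrm{Aut}(C)$ denotes the group of coordinate permutations mapping the code $C$ into itself. -}

module Defs where

open import Level using () renaming (suc to lsuc)
open import Data.Bool using (Bool; true; false; _xor_; _∧_; _∨_; if_then_else_)
open import Data.Nat using (ℕ; zero; suc; _+_; _*_; _∸_; _^_; _≤_; _<_; _%_; _≡ᵇ_)
open import Data.Fin using (Fin; toℕ)
open import Data.Vec using (Vec; []; _∷_; lookup; map; tabulate; allFin; zipWith; replicate; init; last)
open import Data.List using (List; length)
open import Data.List.Relation.Unary.Unique.Propositional using (Unique)
open import Data.List.Membership.Propositional using (_∈_)
open import Data.Product using (Σ; _×_; _,_)
open import Data.Unit using (⊤)
open import Relation.Binary.PropositionalEquality using (_≡_; _≢_)

BVec : ℕ → Set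
BVec k = Vec Bool k

vzero : ∀ {k} → BVec k
vzero = replicate _ false

_⊕_ : ∀ {k} → BVec k → BVec k → BVec k
_⊕_ = zipWith _xor_

wt : ∀ {k} → BVec k → ℕ
wt [] = 0
wt (b ∷ v) = (if b then 1 else 0) + wt v

dot : ∀ {k} → BVec k → BVec k → Bool
dot [] [] = false
dot (a ∷ u) (b ∷ w) = (a ∧ b) xor dot u w

parity : ∀ {k} → BVec k → Bool
parity [] = false
parity (b ∷ v) = b xor parity v

-- GF(2^m) as F₂[x]/(p(x)), p(x) = x^m + Σ_{j<m} p_j x^j, with p given by
-- its lower coefficient vector (p_0,…,p_{m-1}).  An element Σ v_j x^j is
-- its coordinate vector (v_0,…,v_{m-1}) w.r.t. the basis 1,x,…,x^{m-1}.

mulX : ∀ {m} → BVec m → BVec m → BVec m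
mulX {zero} p v = []
mulX {suc k} p v = if last v then (false ∷ init v) ⊕ p else false ∷ init v

oneV : ∀ {m} → BVec m
oneV {zero} = []
oneV {suc k} = true ∷ replicate k false

alphaPow : ∀ {m} → BVec m → ℕ → BVec m
alphaPow p zero = oneV
alphaPow p (suc i) = mulX p (alphaPow p i)

-- α = x mod p has multiplicative order exactly 2^m - 1, i.e. p is a
-- primitive polynomial (this forces F₂[x]/(p) to be the field GF(2^m) and
-- α to be a primitive element of it).
IsPrimitive : ∀ {m} → BVec m → Set
IsPrimitive {m} p =
  (alphaPow p (2 ^ m ∸ 1) ≡ oneV) ×
  (∀ i → 1 ≤ i → i < 2 ^ m ∸ 1 → alphaPow p i ≢ oneV)

HMat : ∀ {m} → BVec m → Vec (BVec m) (2 ^ m ∸ 1)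
HMat p = tabulate (λ i → alphaPow p (toℕ i))

synd : ∀ {m k} → Vec (BVec m) k → BVec k → BVec m
synd [] [] = vzero
synd (h ∷ hs) (b ∷ c) = (if b then h else vzero) ⊕ synd hs c

vRow : ∀ {m} → BVec m → Fin 4 → Fin 4 → BVec (2 ^ m ∸ 1)
vRow p i₁ i₂ = map (λ h → (wt h % 4 ≡ᵇ toℕ i₁) ∨ (wt h % 4 ≡ᵇ toℕ i₂)) (HMat p)

InC : ∀ {m} → BVec m → Fin 4 → Fin 4 → BVec (2 ^ m ∸ 1) → Set
InC p i₁ i₂ c = (synd (HMat p) c ≡ vzero) × (dot (vRow p i₁ i₂) c ≡ false)

-- extended code; coordinate 0 of the extended word is c_∞
Ext : ∀ {k} → (BVec k → Set) → BVec (suc k) → Set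
Ext C (x ∷ c) = C c × (x ≡ parity c)

Perm : ℕ → Set
Perm k = Vec (Fin k) k

IsPerm : ∀ {k} → Perm k → Set
IsPerm σ = ∀ i j → lookup σ i ≡ lookup σ j → i ≡ j

permute : ∀ {k} → Perm k → BVec k → BVec k
permute σ c = map (lookup c) σ

_∘ₚ_ : ∀ {k} → Perm k → Perm k → Perm k
σ ∘ₚ τ = map (lookup σ) τ

idₚ : ∀ {k} → Perm k
idₚ = allFin _

IsAut : ∀ {k} → (BVec k → Set) → Perm k → Set
IsAut C σ = IsPerm σ × (∀ c → C c → C (permute σ c))

record GroupIso {A B : Set} (P : A → Set) (_·_ : A → A → A)
                (Q : B → Set) (_∗_ : B → B → B) : Set where
  field
    f    : A → B
    pres : ∀ x → P x → Q (f x)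
    hom  : ∀ x y → P x → P y → f (x · y) ≡ f x ∗ f y
    inj  : ∀ x y → P x → P y → f x ≡ f y → x ≡ y
    surj : ∀ y → Q y → Σ A (λ x → P x × f x ≡ y)

IsSubgroup : ∀ {k} → (Perm k → Set) → (Perm k → Set) → Set
IsSubgroup G H =
  (∀ x → H x → G x) × H idₚ × (∀ x y → H x → H y → H (x ∘ₚ y))

record SemidirectF2 {k j : ℕ} (G : Perm k → Set) (K : Perm j → Set) (m : ℕ)
                    : Set₁ where
  field
    H N    : Perm k → Set
    H-sub  : IsSubgroup G H
    N-sub  : IsSubgroup G N
    N-norm : ∀ g x → G g → N x → Σ (Perm k) (λ y → N y × (g ∘ₚ x ≡ y ∘ₚ g))
    meet   : ∀ x → N x → H x → x ≡ idₚ
    prod   : ∀ g → G g → Σ (Perm k) (λ x → Σ (Perm k) (λ h →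
               N x × H h × (g ≡ x ∘ₚ h)))
    H≅K    : GroupIso K _∘ₚ_ H _∘ₚ_
    N≅F₂ᵐ  : GroupIso {BVec m} (λ _ → ⊤) _⊕_ N _∘ₚ_

HasOrder : ∀ {k} → (Perm k → Set) → ℕ → Set
HasOrder {k} G N = Σ (List (Perm k)) (λ L →
  Unique L × (∀ σ → σ ∈ L → G σ) × (∀ σ → G σ → σ ∈ L) × (length L ≡ N))

-- (2^m-1)·2^{m-1}·(2^{m-2}-1)·2^{m-3}⋯(2^2-1)·2  (for m even):
-- factor j is 2^j - 1 for j even and 2^j for j odd.
factor : ℕ → ℕ
factor j = if j % 2 ≡ᵇ 0 then 2 ^ j ∸ 1 else 2 ^ j

ordProd : ℕ → ℕ
ordProd zero = 1
ordProd (suc j) = factor (suc j) * ordProd j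

{-# OPTIONS --safe #-}
-- The dual of C* is spanned on F₂ᵐ (with ∞ placed at the vector 0) by the
-- affine functions and a quadratic form Q whose polar form B is alternating
-- and, m being even, nondegenerate.  So {x , y , z , x + y + z} supports a word of C*
-- iff B (x + z) (y + z) = 0.  An automorphism preserves these isotropic planes;
-- after moving the image of 0 back to 0 it is additive on orthogonal pairs, hence,
-- for m ≥ 4, linear, and it preserves B.  Conversely an affine isometry changes Q
-- only by an affine function, so Aut(C*) = F₂ᵐ ⋊ Sp(m,2), with Aut(C) the
-- stabiliser of 0.  Symplectic maps correspond to the images of a fixed hyperbolic
-- basis, and those are counted one hyperbolic pair at a time, passing to the
-- orthogonal complement: (2ᵐ - 1) 2ᵐ⁻¹ choices for the first pair, and so on.
module Submission where

open import Defs
open import Algebra.Bundles using (CommutativeMonoid)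
open import Algebra.Properties.CommutativeMonoid.Sum using (sum; sum-permute; sum-cong-≗)
open import Data.Bool using (Bool; true; false; _xor_; _∧_; _∨_; if_then_else_)
import Data.Bool.Properties as Bool
open import Data.Fin using (Fin; zero; suc; toℕ; combine; punchOut)
open import Data.Fin.Patterns using (0F; 1F; 2F; 3F; 4F; 5F)
open import Data.Fin.Permutation using (permutation)
import Data.Fin.Properties as Fin
open import Data.List as List using (List; []; _∷_; _++_; length; filter; concatMap)
open import Data.List.Membership.Propositional using (_∈_; lose; find)
open import Data.List.Membership.Propositional.Properties
  using (∈-∃++; ∈-++⁺ˡ; ∈-++⁺ʳ; ∈-++⁻; ∈-map⁺; ∈-map⁻; ∈-filter⁺; ∈-filter⁻;
         ∈-concatMap⁺; ∈-concatMap⁻; ∈-tabulate⁺)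
import Data.List.Properties as List
open import Data.List.Relation.Unary.All as All using ([]; _∷_)
open import Data.List.Relation.Unary.AllPairs using ([]; _∷_)
open import Data.List.Relation.Unary.Any using (here; there)
open import Data.List.Relation.Unary.Unique.Propositional using (Unique)
import Data.List.Relation.Unary.Unique.Propositional.Properties as Unique
open import Data.Nat using (ℕ; zero; suc; _+_; _*_; _∸_; _^_; _≤_; _<_; _%_; _≡ᵇ_; z≤n; s≤s)
open import Data.Nat.Divisibility using (divides; m%n≡0⇒n∣m)
open import Data.Nat.DivMod using (%-distribˡ-+; m*n%n≡0; [m+kn]%n≡m%n)
import Data.Nat.Properties as ℕ
open import Data.Product using (Σ; ∃; _×_; _,_; proj₁; proj₂)
open import Data.Sum using (inj₁; inj₂)
open import Data.Unit using (⊤; tt)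
open import Data.Vec using (Vec; []; _∷_; lookup; map; tabulate; head; tail; init; last; replicate)
import Data.Vec.Properties as Vec
open import Function using (_∘_)
open import Relation.Binary.Definitions using (DecidableEquality; tri<; tri≈; tri>)
open import Relation.Binary.PropositionalEquality
open import Relation.Nullary using (¬_; ¬?; yes; no; contradiction)

-- Boolean identities by truth table

-- Primitivity serves to label the coordinates of C* by the vectors of F₂ᵐ. A word is then a linear
-- relation among the columns (1, Q x, x), so a permutation of the points that extends to a linear
-- map of these columns preserves the code. The obstacle is the converse, where only the effect on
-- words is known. Words of weight four suffice: additivity spreads from orthogonal to hyperbolic
-- pairs as soon as any two vectors have a common nonzero orthogonal vector, and this is where m ≥ 4
-- enters, through the existence of more than four vectors. Permuting a word by σ moves the columns
-- by the inverse of σ, so both implications pass through the inverse map. Excluding the residue 0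
-- makes the appended row, extended by 0 at ∞, agree with Q at the vector 0. For the count,
-- subspaces are lists without repetitions, dimension is read off from length, and a hyperbolic
-- basis exists because the number of such bases is positive.

BoolFun : ℕ → Set
BoolFun zero    = Bool
BoolFun (suc n) = Bool → BoolFun n

Pointwise≡ : ∀ n → BoolFun n → BoolFun n → Set
Pointwise≡ zero    a b = a ≡ b
Pointwise≡ (suc n) f g = ∀ x → Pointwise≡ n (f x) (g x)

agree : ∀ n → BoolFun n → BoolFun n → Bool
agree zero    true  b = b
agree zero    false b = b xor true
agree (suc n) f     g = agree n (f true) (g true) ∧ agree n (f false) (g false)

∧-split : ∀ {a b} → a ∧ b ≡ true → a ≡ true × b ≡ true
∧-split {true} {true} _ = refl , refl

-- The hypothesis is a closed Boolean whenever f and g are closed, so `refl` settles all 2ⁿ cases;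
-- the conclusion is then applied to parities and values of forms as if they were variables.
truthTable : ∀ n (f g : BoolFun n) → agree n f g ≡ true → Pointwise≡ n f g
truthTable zero    true  true  _ = refl
truthTable zero    false false _ = refl
truthTable (suc n) f g h true  = truthTable n _ _ (proj₁ (∧-split h))
truthTable (suc n) f g h false = truthTable n _ _ (proj₂ (∧-split {agree n (f true) (g true)} h))

-- The elementary abelian group F₂ᵏ

-- The same `if` as in `synd`, so that laws of scalars apply directly to the summands of a syndrome.
_·_ : ∀ {k} → Bool → BVec k → BVec k
b · h = if b then h else vzero

_≟ᵥ_ : ∀ {k} → DecidableEquality (BVec k)
_≟ᵥ_ = Vec.≡-dec Bool._≟_

⊕-assoc : ∀ {k} (x y z : BVec k) → (x ⊕ y) ⊕ z ≡ x ⊕ (y ⊕ z)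
⊕-assoc = Vec.zipWith-assoc Bool.xor-assoc

⊕-comm : ∀ {k} (x y : BVec k) → x ⊕ y ≡ y ⊕ x
⊕-comm = Vec.zipWith-comm Bool.xor-comm

⊕-identityˡ : ∀ {k} (x : BVec k) → vzero ⊕ x ≡ x
⊕-identityˡ = Vec.zipWith-identityˡ Bool.xor-identityˡ

⊕-identityʳ : ∀ {k} (x : BVec k) → x ⊕ vzero ≡ x
⊕-identityʳ = Vec.zipWith-identityʳ Bool.xor-identityʳ

⊕-same : ∀ {k} (x : BVec k) → x ⊕ x ≡ vzero
⊕-same []      = refl
⊕-same (b ∷ x) = cong₂ _∷_ (Bool.xor-same b) (⊕-same x)

⊕-commutativeMonoid : ℕ → CommutativeMonoid _ _
⊕-commutativeMonoid k = record
  { Carrier = BVec k ; _≈_ = _≡_ ; _∙_ = _⊕_ ; ε = vzero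
  ; isCommutativeMonoid = record
    { isMonoid = record
      { isSemigroup = record
        { isMagma = record { isEquivalence = isEquivalence ; ∙-cong = cong₂ _⊕_ }
        ; assoc = ⊕-assoc }
      ; identity = ⊕-identityˡ , ⊕-identityʳ }
    ; comm = ⊕-comm } }

⊕-interchange : ∀ {k} (a b c d : BVec k) → (a ⊕ b) ⊕ (c ⊕ d) ≡ (a ⊕ c) ⊕ (b ⊕ d)
⊕-interchange []      []      []      []      = refl
⊕-interchange (a ∷ x) (b ∷ y) (c ∷ z) (d ∷ w) = cong₂ _∷_
  (truthTable 4 (λ a b c d → (a xor b) xor (c xor d)) (λ a b c d → (a xor c) xor (b xor d)) refl a b c d)
  (⊕-interchange x y z w)

·-⊕ : ∀ {k} (a b : Bool) (h : BVec k) → (a xor b) · h ≡ (a · h) ⊕ (b · h)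
·-⊕ true  true  h = sym (⊕-same h)
·-⊕ true  false h = sym (⊕-identityʳ h)
·-⊕ false b     h = sym (⊕-identityˡ (b · h))

synd-⊕ : ∀ {m k} (hs : Vec (BVec m) k) c d → synd hs (c ⊕ d) ≡ synd hs c ⊕ synd hs d
synd-⊕ []       []      []      = sym (⊕-identityˡ _)
synd-⊕ (h ∷ hs) (a ∷ c) (b ∷ d) =
  trans (cong₂ _⊕_ (·-⊕ a b h) (synd-⊕ hs c d)) (⊕-interchange (a · h) (b · h) _ _)

synd-vzero : ∀ {m k} (hs : Vec (BVec m) k) → synd hs vzero ≡ vzero
synd-vzero []       = refl
synd-vzero (h ∷ hs) = trans (⊕-identityˡ _) (synd-vzero hs)

unit : ∀ {k} → Fin k → BVec k
unit zero    = true ∷ vzero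
unit (suc i) = false ∷ unit i

synd-unit : ∀ {m k} (hs : Vec (BVec m) k) i → synd hs (unit i) ≡ lookup hs i
synd-unit (h ∷ hs) zero    = trans (cong (h ⊕_) (synd-vzero hs)) (⊕-identityʳ h)
synd-unit (h ∷ hs) (suc i) = trans (⊕-identityˡ _) (synd-unit hs i)

-- Identities between sums of vectors are decided by comparing the
-- coefficient vectors of both sides; `synd` evaluates a coefficient vector.

data Sum (k : ℕ) : Set where
  #_  : Fin k → Sum k
  `0  : Sum k
  _⊞_ : Sum k → Sum k → Sum k

infixl 6 _⊞_
infix  7 #_

⟦_⟧ : ∀ {m k} → Sum k → Vec (BVec m) k → BVec m
⟦ # i   ⟧ ρ = lookup ρ i
⟦ `0    ⟧ ρ = vzero
⟦ s ⊞ t ⟧ ρ = ⟦ s ⟧ ρ ⊕ ⟦ t ⟧ ρ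

coefficients : ∀ {k} → Sum k → BVec k
coefficients (# i)   = unit i
coefficients `0      = vzero
coefficients (s ⊞ t) = coefficients s ⊕ coefficients t

⟦⟧-synd : ∀ {m k} (s : Sum k) (ρ : Vec (BVec m) k) → ⟦ s ⟧ ρ ≡ synd ρ (coefficients s)
⟦⟧-synd (# i)   ρ = sym (synd-unit ρ i)
⟦⟧-synd `0      ρ = sym (synd-vzero ρ)
⟦⟧-synd (s ⊞ t) ρ =
  trans (cong₂ _⊕_ (⟦⟧-synd s ρ) (⟦⟧-synd t ρ)) (sym (synd-⊕ ρ (coefficients s) (coefficients t)))

⊕-solve : ∀ {m k} (ρ : Vec (BVec m) k) (s t : Sum k) →
          coefficients s ≡ coefficients t → ⟦ s ⟧ ρ ≡ ⟦ t ⟧ ρ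
⊕-solve ρ s t eq = trans (⟦⟧-synd s ρ) (trans (cong (synd ρ) eq) (sym (⟦⟧-synd t ρ)))

⊕-twice : ∀ {k} (x t : BVec k) → (x ⊕ t) ⊕ t ≡ x
⊕-twice x t = ⊕-solve (x ∷ t ∷ []) (# 0F ⊞ # 1F ⊞ # 1F) (# 0F) refl

⊕-cancelʳ : ∀ {k} {x y : BVec k} t → x ⊕ t ≡ y ⊕ t → x ≡ y
⊕-cancelʳ {x = x} {y} t eq = trans (sym (⊕-twice x t)) (trans (cong (_⊕ t) eq) (⊕-twice y t))

⊕-cancel : ∀ {k} {x y : BVec k} → x ⊕ y ≡ vzero → x ≡ y
⊕-cancel {x = x} {y} eq =
  trans (sym (⊕-twice x y)) (trans (cong (_⊕ y) eq) (⊕-identityˡ y))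

-- The weight modulo 4 and its quadratic form

parity-⊕ : ∀ {k} (x y : BVec k) → parity (x ⊕ y) ≡ parity x xor parity y
parity-⊕ []      []      = refl
parity-⊕ (a ∷ x) (b ∷ y) = trans (cong ((a xor b) xor_) (parity-⊕ x y))
  (truthTable 4 (λ a b p q → (a xor b) xor (p xor q)) (λ a b p q → (a xor p) xor (b xor q)) refl
    a b (parity x) (parity y))

dot-⊕ : ∀ {k} (x y z : BVec k) → dot (x ⊕ y) z ≡ dot x z xor dot y z
dot-⊕ []      []      []      = refl
dot-⊕ (a ∷ x) (b ∷ y) (c ∷ z) = trans (cong (((a xor b) ∧ c) xor_) (dot-⊕ x y z))
  (truthTable 5 (λ a b c p q → ((a xor b) ∧ c) xor (p xor q))
                (λ a b c p q → ((a ∧ c) xor p) xor ((b ∧ c) xor q)) refl a b c (dot x z) (dot y z))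

dot-comm : ∀ {k} (x y : BVec k) → dot x y ≡ dot y x
dot-comm []      []      = refl
dot-comm (a ∷ x) (b ∷ y) = cong₂ _xor_ (Bool.∧-comm a b) (dot-comm x y)

dot-same : ∀ {k} (x : BVec k) → dot x x ≡ parity x
dot-same []      = refl
dot-same (a ∷ x) = cong₂ _xor_ (Bool.∧-idem a) (dot-same x)

dot-vzeroˡ : ∀ {k} (x : BVec k) → dot vzero x ≡ false
dot-vzeroˡ []      = refl
dot-vzeroˡ (_ ∷ x) = dot-vzeroˡ x

dot-nondegenerate : ∀ {k} (x : BVec k) → x ≢ vzero → ∃ λ y → dot x y ≡ true
dot-nondegenerate []          x≢0 = contradiction refl x≢0
dot-nondegenerate (true  ∷ x) x≢0 =
  true ∷ vzero , cong (true xor_) (trans (dot-comm x vzero) (dot-vzeroˡ x))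
dot-nondegenerate (false ∷ x) x≢0 with dot-nondegenerate x (x≢0 ∘ cong (false ∷_))
... | y , xy = true ∷ y , xy

-- The second bit of the binary expansion of the weight, i.e. Σ_{i<j} xᵢxⱼ.
e₂ : ∀ {k} → BVec k → Bool
e₂ []      = false
e₂ (b ∷ x) = (b ∧ parity x) xor e₂ x

-- This is the sum of xᵢyⱼ over i ≠ j, all products minus the diagonal: the cross terms that appear
-- when `e₂` is expanded on a sum.
polar : ∀ {k} → BVec k → BVec k → Bool
polar x y = (parity x ∧ parity y) xor dot x y

e₂-⊕ : ∀ {k} (x y : BVec k) → e₂ (x ⊕ y) ≡ (e₂ x xor e₂ y) xor polar x y
e₂-⊕ []      []      = refl
e₂-⊕ (a ∷ x) (b ∷ y) = trans
  (cong₂ (λ p e → ((a xor b) ∧ p) xor e) (parity-⊕ x y) (e₂-⊕ x y))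
  (truthTable 7
    (λ a b p q c d s → ((a xor b) ∧ (p xor q)) xor ((c xor d) xor ((p ∧ q) xor s)))
    (λ a b p q c d s → (((a ∧ p) xor c) xor ((b ∧ q) xor d)) xor
                       (((a xor p) ∧ (b xor q)) xor ((a ∧ b) xor s)))
    refl a b (parity x) (parity y) (e₂ x) (e₂ y) (dot x y))

residue : Bool → Bool → ℕ
residue false false = 0
residue true  false = 1
residue false true  = 2
residue true  true  = 3

-- Prepending a 1 increments a binary number: the low digit flips and the carry into the second
-- digit is the old parity, which is the recursion of `e₂`.
wt%4 : ∀ {k} (x : BVec k) → wt x % 4 ≡ residue (parity x) (e₂ x)
wt%4 []          = refl
wt%4 (false ∷ x) = wt%4 x
wt%4 (true  ∷ x) = trans (%-distribˡ-+ 1 (wt x) 4)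
  (trans (cong (λ r → suc r % 4) (wt%4 x)) (carry (parity x) (e₂ x)))
  where
  carry : ∀ a b → suc (residue a b) % 4 ≡ residue (true xor a) (a xor b)
  carry false false = refl
  carry false true  = refl
  carry true  false = refl
  carry true  true  = refl

-- Symplectic and quadratic forms over F₂, and the ones coming from the weight

record SymplecticForm (k : ℕ) : Set where
  field
    B             : BVec k → BVec k → Bool
    B-⊕ˡ          : ∀ x y z → B (x ⊕ y) z ≡ B x z xor B y z
    B-comm        : ∀ x y → B x y ≡ B y x
    B-alternating : ∀ x → B x x ≡ false
    nondegenerate : ∀ x → x ≢ vzero → ∃ λ y → B x y ≡ true

  B-⊕ʳ : ∀ x y z → B x (y ⊕ z) ≡ B x y xor B x z
  B-⊕ʳ x y z = trans (B-comm x (y ⊕ z)) (trans (B-⊕ˡ y z x) (cong₂ _xor_ (B-comm y x) (B-comm z x)))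

  B-vzeroˡ : ∀ x → B vzero x ≡ false
  B-vzeroˡ x = trans (cong (λ z → B z x) (sym (⊕-same vzero)))
                     (trans (B-⊕ˡ vzero vzero x) (Bool.xor-same (B vzero x)))

  B-vzeroʳ : ∀ x → B x vzero ≡ false
  B-vzeroʳ x = trans (B-comm x vzero) (B-vzeroˡ x)

  B-·ˡ : ∀ b x y → B (b · x) y ≡ b ∧ B x y
  B-·ˡ true  x y = refl
  B-·ˡ false x y = B-vzeroˡ y

  B-·ʳ : ∀ b x y → B x (b · y) ≡ b ∧ B x y
  B-·ʳ b x y = trans (B-comm x (b · y)) (trans (B-·ˡ b y x) (cong (b ∧_) (B-comm y x)))

  radical-trivial : ∀ x → (∀ y → B x y ≡ false) → x ≡ vzero
  radical-trivial x x⊥ with x ≟ᵥ vzero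
  ... | yes x≡0 = x≡0
  ... | no  x≢0 with nondegenerate x x≢0
  ...   | y , xy = contradiction (trans (sym xy) (x⊥ y)) λ ()

record QuadraticForm {k : ℕ} (S : SymplecticForm k) : Set where
  open SymplecticForm S
  field
    Q       : BVec k → Bool
    Q-vzero : Q vzero ≡ false
    Q-⊕     : ∀ x y → Q (x ⊕ y) ≡ (Q x xor Q y) xor B x y

ones : ∀ {k} → BVec k
ones = replicate _ true

dot-ones : ∀ {k} (x : BVec k) → dot ones x ≡ parity x
dot-ones []      = refl
dot-ones (b ∷ x) = cong (b xor_) (dot-ones x)

-- Evenness of the dimension is what makes `polar` nondegenerate: in odd dimension the all-ones
-- vector is orthogonal to everything.
parity-ones : ∀ j → parity (ones {j * 2}) ≡ false
parity-ones zero    = refl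
parity-ones (suc j) = trans (cong (λ b → true xor (true xor b)) (parity-ones j)) refl

-- polar x = dot (J x) with J x = x + parity(x)·1, and J is injective
-- because 1 has even weight.
polar-nondegenerate : ∀ j (x : BVec (j * 2)) → x ≢ vzero → ∃ λ y → polar x y ≡ true
polar-nondegenerate j x x≢0 with dot-nondegenerate (x ⊕ (parity x · ones)) J≢0
  where
  J≢0 : x ⊕ (parity x · ones) ≢ vzero
  J≢0 eq with parity x in px
  ... | false = x≢0 (⊕-cancel eq)
  ... | true with trans (sym px) (trans (cong parity (⊕-cancel {x = x} eq)) (parity-ones j))
  ...   | ()
... | y , Jxy = y , trans (Bool.xor-comm (parity x ∧ parity y) (dot x y))
  (trans (cong (dot x y xor_) (sym (adjoint (parity x)))) (trans (sym (dot-⊕ x _ y)) Jxy))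
  where
  adjoint : ∀ b → dot (b · ones) y ≡ b ∧ parity y
  adjoint true  = dot-ones y
  adjoint false = dot-vzeroˡ y

polarForm : ∀ j → SymplecticForm (j * 2)
polarForm j = record
  { B = polar
  ; B-⊕ˡ = λ x y z → trans (cong₂ (λ p d → (p ∧ parity z) xor d) (parity-⊕ x y) (dot-⊕ x y z))
      (truthTable 5 (λ p q r c d → ((p xor q) ∧ r) xor (c xor d))
                    (λ p q r c d → ((p ∧ r) xor c) xor ((q ∧ r) xor d)) refl
        (parity x) (parity y) (parity z) (dot x z) (dot y z))
  ; B-comm = λ x y → cong₂ _xor_ (Bool.∧-comm (parity x) (parity y)) (dot-comm x y)
  ; B-alternating = λ x → trans (cong₂ _xor_ (Bool.∧-idem (parity x)) (dot-same x)) (Bool.xor-same (parity x))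
  ; nondegenerate = polar-nondegenerate j
  }

-- The indicator of wt x ≡ i₁ or i₂ (mod 4) is e₂ for {2,3} and e₂ + parity for {1,2}.
indicator : ∀ {k} → Fin 4 → Fin 4 → BVec k → Bool
indicator i₁ i₂ h = (wt h % 4 ≡ᵇ toℕ i₁) ∨ (wt h % 4 ≡ᵇ toℕ i₂)

indicator-form : ∀ i₁ i₂ → (toℕ i₁ + toℕ i₂) % 2 ≡ 1 → toℕ i₁ ≢ 0 → toℕ i₂ ≢ 0 →
                 ∃ λ c → ∀ {k} (x : BVec k) → indicator i₁ i₂ x ≡ (c ∧ parity x) xor e₂ x
indicator-form i₁ i₂ odd i₁≢0 i₂≢0 with bits i₁ i₂ odd i₁≢0 i₂≢0
  where
  bits : ∀ i₁ i₂ → (toℕ i₁ + toℕ i₂) % 2 ≡ 1 → toℕ i₁ ≢ 0 → toℕ i₂ ≢ 0 →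
         ∃ λ c → ∀ p e → (residue p e ≡ᵇ toℕ i₁) ∨ (residue p e ≡ᵇ toℕ i₂) ≡ (c ∧ p) xor e
  bits 0F _  _ i₁≢0 _ = contradiction refl i₁≢0
  bits _  0F _ _ i₂≢0 = contradiction refl i₂≢0
  bits 1F 3F () _ _
  bits 3F 3F () _ _
  bits 1F 2F _ _ _ = true  , truthTable 2 (λ p e → (residue p e ≡ᵇ 1) ∨ (residue p e ≡ᵇ 2)) (λ p e → p xor e) refl
  bits 2F 1F _ _ _ = true  , truthTable 2 (λ p e → (residue p e ≡ᵇ 2) ∨ (residue p e ≡ᵇ 1)) (λ p e → p xor e) refl
  bits 2F 3F _ _ _ = false , truthTable 2 (λ p e → (residue p e ≡ᵇ 2) ∨ (residue p e ≡ᵇ 3)) (λ p e → e) refl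
  bits 3F 2F _ _ _ = false , truthTable 2 (λ p e → (residue p e ≡ᵇ 3) ∨ (residue p e ≡ᵇ 2)) (λ p e → e) refl
... | c , table = c , λ x →
  trans (cong (λ r → (r ≡ᵇ toℕ i₁) ∨ (r ≡ᵇ toℕ i₂)) (wt%4 x)) (table (parity x) (e₂ x))

parity-vzero : ∀ k → parity (vzero {k}) ≡ false
parity-vzero zero    = refl
parity-vzero (suc k) = parity-vzero k

e₂-vzero : ∀ k → e₂ (vzero {k}) ≡ false
e₂-vzero zero    = refl
e₂-vzero (suc k) = e₂-vzero k

-- Adding the linear function `parity` to `e₂` leaves the polar form unchanged, so all admissible
-- residue pairs share one symplectic form.
indicatorForm : ∀ j i₁ i₂ → (toℕ i₁ + toℕ i₂) % 2 ≡ 1 → toℕ i₁ ≢ 0 → toℕ i₂ ≢ 0 →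
                Σ (QuadraticForm (polarForm j)) λ q → ∀ x → QuadraticForm.Q q x ≡ indicator i₁ i₂ x
indicatorForm j i₁ i₂ odd i₁≢0 i₂≢0 with indicator-form i₁ i₂ odd i₁≢0 i₂≢0
... | c , form = record
  { Q = λ x → (c ∧ parity x) xor e₂ x
  ; Q-vzero = trans (cong₂ (λ p e → (c ∧ p) xor e) (parity-vzero (j * 2)) (e₂-vzero (j * 2)))
                    (cong (_xor false) (Bool.∧-zeroʳ c))
  ; Q-⊕ = λ x y → trans (cong₂ (λ p e → (c ∧ p) xor e) (parity-⊕ x y) (e₂-⊕ x y))
      (truthTable 6 (λ c p q d e s → (c ∧ (p xor q)) xor ((d xor e) xor s))
                    (λ c p q d e s → (((c ∧ p) xor d) xor ((c ∧ q) xor e)) xor s) refl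
        c (parity x) (parity y) (e₂ x) (e₂ y) (polar x y))
  } , λ x → sym (form x)

-- The powers of α exhaust the nonzero vectors

injective⇒surjective : ∀ {n} (f : Fin n → Fin n) → (∀ i j → f i ≡ f j → i ≡ j) →
                       ∀ j → ∃ λ i → f i ≡ j
injective⇒surjective {suc n} f f-inj j with Fin.any? (λ i → f i Fin.≟ j)
... | yes hit  = hit
... | no  miss = contradiction (Fin.injective⇒≤ {f = avoid} avoid-injective) ℕ.1+n≰n
  where
  j≢f : ∀ i → j ≢ f i
  j≢f i eq = miss (i , sym eq)
  avoid : Fin (suc n) → Fin n
  avoid i = punchOut (j≢f i)
  avoid-injective : ∀ {i i′} → avoid i ≡ avoid i′ → i ≡ i′
  avoid-injective eq = f-inj _ _ (Fin.punchOut-injective (j≢f _) (j≢f _) eq)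

encode : ∀ {k} → BVec k → Fin (2 ^ k)
encode []          = zero
encode (true  ∷ x) = combine {2} (suc zero) (encode x)
encode (false ∷ x) = combine {2} zero (encode x)

encode-injective : ∀ {k} (x y : BVec k) → encode x ≡ encode y → x ≡ y
encode-injective []      []      _  = refl
encode-injective (true  ∷ x) (true  ∷ y) eq =
  cong (true ∷_) (encode-injective x y (Fin.combine-injectiveʳ {2} 1F (encode x) 1F (encode y) eq))
encode-injective (false ∷ x) (false ∷ y) eq =
  cong (false ∷_) (encode-injective x y (Fin.combine-injectiveʳ {2} 0F (encode x) 0F (encode y) eq))
encode-injective (true  ∷ x) (false ∷ y) eq
  with () ← Fin.combine-injectiveˡ {2} 1F (encode x) 0F (encode y) eq
encode-injective (false ∷ x) (true  ∷ y) eq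
  with () ← Fin.combine-injectiveˡ {2} 0F (encode x) 1F (encode y) eq

enumeration-surjective : ∀ {k n} → n ≡ 2 ^ k → (E : Fin n → BVec k) →
                         (∀ i j → E i ≡ E j → i ≡ j) → ∀ x → ∃ λ i → E i ≡ x
enumeration-surjective refl E E-inj x
  with injective⇒surjective (encode ∘ E) (λ i j eq → E-inj i j (encode-injective _ _ eq)) (encode x)
... | i , eq = i , encode-injective _ _ eq

last-vzero : ∀ k → last (vzero {suc k}) ≡ false
last-vzero zero    = refl
last-vzero (suc k) = last-vzero k

init-vzero : ∀ k → init (vzero {suc k}) ≡ vzero
init-vzero zero    = refl
init-vzero (suc k) = cong (false ∷_) (init-vzero k)

mulX-vzero : ∀ {m} (p : BVec m) → mulX p vzero ≡ vzero
mulX-vzero {zero}  p = refl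
mulX-vzero {suc k} p rewrite last-vzero k = cong (false ∷_) (init-vzero k)

alphaPow-shift : ∀ {m} (p : BVec m) k i j → alphaPow p i ≡ alphaPow p j →
                 alphaPow p (k + i) ≡ alphaPow p (k + j)
alphaPow-shift p zero    i j eq = eq
alphaPow-shift p (suc k) i j eq = cong (mulX p) (alphaPow-shift p k i j eq)

alphaPow-vzero : ∀ {m} (p : BVec m) k i → alphaPow p i ≡ vzero → alphaPow p (k + i) ≡ vzero
alphaPow-vzero p zero    i eq = eq
alphaPow-vzero p (suc k) i eq = trans (cong (mulX p) (alphaPow-vzero p k i eq)) (mulX-vzero p)

module Powers {m : ℕ} (p : BVec (suc m)) (prim : IsPrimitive p) where

  private
    n = 2 ^ suc m ∸ 1

  oneV≢vzero : oneV {suc m} ≢ vzero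
  oneV≢vzero ()

  -- Zero is absorbing under `mulX`, so a vanishing power would still vanish at exponent n, where
  -- the value is 1.
  alphaPow≢vzero : ∀ i → i < n → alphaPow p i ≢ vzero
  alphaPow≢vzero i i<n eq = oneV≢vzero (trans (sym (proj₁ prim))
    (subst (λ k → alphaPow p k ≡ vzero) (ℕ.m∸n+n≡m (ℕ.<⇒≤ i<n)) (alphaPow-vzero p (n ∸ i) i eq)))

  -- Multiplying a collision by the power n - j turns one side into 1 and leaves on the other an
  -- exponent strictly between 0 and n. No inverses in the field are taken.
  alphaPow-distinct : ∀ i j → i < j → j < n → alphaPow p i ≢ alphaPow p j
  alphaPow-distinct i j i<j j<n eq = proj₂ prim (n ∸ j + i)
    (ℕ.≤-trans (ℕ.m<n⇒0<n∸m j<n) (ℕ.m≤m+n _ i))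
    (subst (n ∸ j + i <_) n∸j+j≡n (ℕ.+-monoʳ-< (n ∸ j) i<j))
    (trans (alphaPow-shift p (n ∸ j) i j eq) (trans (cong (alphaPow p) n∸j+j≡n) (proj₁ prim)))
    where
    n∸j+j≡n : n ∸ j + j ≡ n
    n∸j+j≡n = ℕ.m∸n+n≡m (ℕ.<⇒≤ j<n)

  -- Index 0 stands for the coordinate ∞, which is attached to the zero vector.
  E : Fin (suc n) → BVec (suc m)
  E zero    = vzero
  E (suc i) = alphaPow p (toℕ i)

  E-injective : ∀ i j → E i ≡ E j → i ≡ j
  E-injective zero    zero    _  = refl
  E-injective zero    (suc j) eq = contradiction (sym eq) (alphaPow≢vzero (toℕ j) (Fin.toℕ<n j))
  E-injective (suc i) zero    eq = contradiction eq (alphaPow≢vzero (toℕ i) (Fin.toℕ<n i))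
  E-injective (suc i) (suc j) eq with ℕ.<-cmp (toℕ i) (toℕ j)
  ... | tri< i<j _ _ = contradiction eq (alphaPow-distinct (toℕ i) (toℕ j) i<j (Fin.toℕ<n j))
  ... | tri≈ _ i≡j _ = cong suc (Fin.toℕ-injective i≡j)
  ... | tri> _ _ j<i = contradiction (sym eq) (alphaPow-distinct (toℕ j) (toℕ i) j<i (Fin.toℕ<n i))

  1+n≡2^m : suc n ≡ 2 ^ suc m
  1+n≡2^m = ℕ.m+[n∸m]≡n {1} (ℕ.m^n>0 2 (suc m))

  E-surjective : ∀ x → ∃ λ i → E i ≡ x
  E-surjective = enumeration-surjective 1+n≡2^m E E-injective

-- Isometries of a symplectic form, and maps additive on orthogonal pairs

⊕-idempotent : ∀ {k} {x : BVec k} → x ⊕ x ≡ x → x ≡ vzero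
⊕-idempotent {x = x} eq = trans (sym eq) (⊕-same x)

module Isometries {k : ℕ} (S : SymplecticForm k) where
  open SymplecticForm S

  infix 4 _⊥_
  _⊥_ : BVec k → BVec k → Set
  x ⊥ y = B x y ≡ false

  ⊥-sym : ∀ {x y} → x ⊥ y → y ⊥ x
  ⊥-sym {x} {y} xy = trans (B-comm y x) xy

  ⊥-⊕ˡ : ∀ {x y z} → x ⊥ z → y ⊥ z → x ⊕ y ⊥ z
  ⊥-⊕ˡ xz yz = trans (B-⊕ˡ _ _ _) (cong₂ _xor_ xz yz)

  ⊥-⊕ʳ : ∀ {x y z} → x ⊥ y → x ⊥ z → x ⊥ y ⊕ z
  ⊥-⊕ʳ xy xz = trans (B-⊕ʳ _ _ _) (cong₂ _xor_ xy xz)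

  ⊥-·ˡ : ∀ b {x y} → x ⊥ y → b · x ⊥ y
  ⊥-·ˡ b xy = trans (B-·ˡ b _ _) (trans (cong (b ∧_) xy) (Bool.∧-zeroʳ b))

  -- The component of w orthogonal to the hyperbolic pair (u , v).
  project : BVec k → BVec k → BVec k → BVec k
  project u v w = w ⊕ ((B w v · u) ⊕ (B w u · v))

  project-⊥ˡ : ∀ {u v} w → B u v ≡ true → project u v w ⊥ u
  project-⊥ˡ {u} {v} w uv = begin
    B (project u v w) u                                    ≡⟨ B-⊕ˡ _ _ _ ⟩
    B w u xor B ((B w v · u) ⊕ (B w u · v)) u               ≡⟨ cong (B w u xor_) (B-⊕ˡ _ _ _) ⟩
    B w u xor (B (B w v · u) u xor B (B w u · v) u)         ≡⟨ cong (B w u xor_) (cong₂ _xor_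
                                                                (⊥-·ˡ (B w v) (B-alternating u)) (B-·ˡ _ v u)) ⟩
    B w u xor (B w u ∧ B v u)                               ≡⟨ cong (λ b → B w u xor (B w u ∧ b)) (trans (B-comm v u) uv) ⟩
    B w u xor (B w u ∧ true)                                ≡⟨ truthTable 1 (λ b → b xor (b ∧ true)) (λ _ → false) refl (B w u) ⟩
    false                                                   ∎
    where open ≡-Reasoning

  project-swap : ∀ u v w → project u v w ≡ project v u w
  project-swap u v w = cong (w ⊕_) (⊕-comm _ _)

  project-⊥ʳ : ∀ {u v} w → B u v ≡ true → project u v w ⊥ v
  project-⊥ʳ {u} {v} w uv = subst (_⊥ v) (project-swap v u w) (project-⊥ˡ w (trans (B-comm v u) uv))

  B-project : ∀ {u v z} w → z ⊥ u → z ⊥ v → B z (project u v w) ≡ B z w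
  B-project {u} {v} {z} w zu zv = begin
    B z (project u v w)                             ≡⟨ B-⊕ʳ _ _ _ ⟩
    B z w xor B z ((B w v · u) ⊕ (B w u · v))        ≡⟨ cong (B z w xor_) (⊥-⊕ʳ
                                                        (⊥-sym (⊥-·ˡ (B w v) (⊥-sym zu)))
                                                        (⊥-sym (⊥-·ˡ (B w u) (⊥-sym zv)))) ⟩
    B z w xor false                                 ≡⟨ Bool.xor-identityʳ _ ⟩
    B z w                                           ∎
    where open ≡-Reasoning

  unproject : ∀ u v w → w ≡ ((B w v · u) ⊕ (B w u · v)) ⊕ project u v w
  unproject u v w = ⊕-solve (w ∷ (B w v · u) ∷ (B w u · v) ∷ [])
    (# 0F) ((# 1F ⊞ # 2F) ⊞ (# 0F ⊞ (# 1F ⊞ # 2F))) refl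

  record Isometry (A : BVec k → BVec k) : Set where
    field
      additive  : ∀ x y → A (x ⊕ y) ≡ A x ⊕ A y
      preserves : ∀ x y → B (A x) (A y) ≡ B x y

    vzero-fixed : A vzero ≡ vzero
    vzero-fixed = ⊕-idempotent (trans (sym (additive vzero vzero)) (cong A (⊕-same vzero)))

    -- Injectivity comes from the form: a vector sent to 0 is orthogonal to everything.
    kernel : ∀ x → A x ≡ vzero → x ≡ vzero
    kernel x Ax≡0 = radical-trivial x λ y →
      trans (sym (preserves x y)) (trans (cong (λ z → B z (A y)) Ax≡0) (B-vzeroˡ (A y)))

    injective : ∀ x y → A x ≡ A y → x ≡ y
    injective x y eq = ⊕-cancel (kernel (x ⊕ y)
      (trans (additive x y) (trans (cong (_⊕ A y) eq) (⊕-same (A y)))))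

  record AffineIsometry (g : BVec k → BVec k) : Set where
    field
      linear      : BVec k → BVec k
      translation : BVec k
      isometry    : Isometry linear
      affine      : ∀ x → g x ≡ linear x ⊕ translation
    open Isometry isometry public

    affine-injective : ∀ x y → g x ≡ g y → x ≡ y
    affine-injective x y eq = injective x y (⊕-cancelʳ translation (trans (sym (affine x)) (trans eq (affine y))))

  -- The candidate linear part of h is h x + h 0. Applying the linear part of g to it cancels the
  -- translation and returns x, and injectivity then transfers additivity.
  inverse-affineIsometry : ∀ {g h} → (∀ x → g (h x) ≡ x) → AffineIsometry g → AffineIsometry h
  inverse-affineIsometry {g} {h} gh G = record
    { linear = A⁻¹ ; translation = h vzero
    ; isometry = record
      { additive = λ x y → injective _ _ (trans (A∘A⁻¹ (x ⊕ y))
          (sym (trans (additive (A⁻¹ x) (A⁻¹ y)) (cong₂ _⊕_ (A∘A⁻¹ x) (A∘A⁻¹ y)))))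
      ; preserves = λ x y → trans (sym (preserves (A⁻¹ x) (A⁻¹ y))) (cong₂ B (A∘A⁻¹ x) (A∘A⁻¹ y)) }
    ; affine = λ x → sym (⊕-twice (h x) (h vzero)) }
    where
    open AffineIsometry G
    A⁻¹ : BVec k → BVec k
    A⁻¹ x = h x ⊕ h vzero
    t = translation
    A∘A⁻¹ : ∀ x → linear (A⁻¹ x) ≡ x
    A∘A⁻¹ x = begin
      linear (h x ⊕ h vzero)                            ≡⟨ additive (h x) (h vzero) ⟩
      linear (h x) ⊕ linear (h vzero)                   ≡⟨ ⊕-solve (linear (h x) ∷ linear (h vzero) ∷ t ∷ [])
                                                            (# 0F ⊞ # 1F) ((# 0F ⊞ # 2F) ⊞ (# 1F ⊞ # 2F)) refl ⟩
      (linear (h x) ⊕ t) ⊕ (linear (h vzero) ⊕ t)       ≡⟨ cong₂ _⊕_ (sym (affine (h x))) (sym (affine (h vzero))) ⟩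
      g (h x) ⊕ g (h vzero)                             ≡⟨ cong₂ _⊕_ (gh x) (gh vzero) ⟩
      x ⊕ vzero                                         ≡⟨ ⊕-identityʳ x ⟩
      x                                                 ∎
      where open ≡-Reasoning

  -- A surjection fixing 0 that is additive on orthogonal pairs is additive:
  -- its defect δ on a hyperbolic pair agrees with the defect on any hyperbolic
  -- pair orthogonal to it, hence is orthogonal to the whole image.
  module OrthogonallyAdditive
    (A A⁻¹ : BVec k → BVec k) (A∘A⁻¹ : ∀ x → A (A⁻¹ x) ≡ x) (A⁻¹∘A : ∀ x → A⁻¹ (A x) ≡ x)
    (A-vzero : A vzero ≡ vzero)
    (additive⊥ : ∀ x y → x ⊥ y → A (x ⊕ y) ≡ A x ⊕ A y)
    (preserves⊥ : ∀ x y → x ⊥ y → A x ⊥ A y)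
    (common⊥ : ∀ x y → ∃ λ z → z ≢ vzero × z ⊥ x × z ⊥ y)
    where

    δ : BVec k → BVec k → BVec k
    δ x y = A (x ⊕ y) ⊕ (A x ⊕ A y)

    ⊥δ : ∀ {x y z} → z ⊥ x → z ⊥ y → A z ⊥ δ x y
    ⊥δ zx zy = ⊥-⊕ʳ (preserves⊥ _ _ (⊥-⊕ʳ zx zy)) (⊥-⊕ʳ (preserves⊥ _ _ zx) (preserves⊥ _ _ zy))

    -- Although neither pair is orthogonal, x + z ⊥ y + w because the two values 1 cancel. So A (x +
    -- y + z + w) can be expanded along (x + y) + (z + w) and along (x + z) + (y + w), and the two
    -- expansions differ by the sum of the defects.
    δ-constant : ∀ {x y z w} → B x y ≡ true → B z w ≡ true →
                 z ⊥ x → z ⊥ y → w ⊥ x → w ⊥ y → δ x y ≡ δ z w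
    δ-constant {x} {y} {z} {w} xy zw zx zy wx wy = ⊕-cancel (begin
      δ x y ⊕ δ z w
        ≡⟨ ⊕-solve (A (x ⊕ y) ∷ A x ∷ A y ∷ A (z ⊕ w) ∷ A z ∷ A w ∷ [])
             ((# 0F ⊞ (# 1F ⊞ # 2F)) ⊞ (# 3F ⊞ (# 4F ⊞ # 5F)))
             ((# 0F ⊞ # 3F) ⊞ ((# 1F ⊞ # 4F) ⊞ (# 2F ⊞ # 5F))) refl ⟩
      (A (x ⊕ y) ⊕ A (z ⊕ w)) ⊕ ((A x ⊕ A z) ⊕ (A y ⊕ A w))
        ≡⟨ cong₂ _⊕_ (sym (additive⊥ _ _ (⊥-sym (⊥-⊕ʳ (⊥-⊕ˡ zx wx) (⊥-⊕ˡ zy wy)))))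
                     (cong₂ _⊕_ (sym (additive⊥ _ _ (⊥-sym zx))) (sym (additive⊥ _ _ (⊥-sym wy)))) ⟩
      A ((x ⊕ y) ⊕ (z ⊕ w)) ⊕ (A (x ⊕ z) ⊕ A (y ⊕ w))
        ≡⟨ cong₂ _⊕_ (cong A (⊕-interchange x y z w)) (sym (additive⊥ _ _ x+z⊥y+w)) ⟩
      A ((x ⊕ z) ⊕ (y ⊕ w)) ⊕ A ((x ⊕ z) ⊕ (y ⊕ w))
        ≡⟨ ⊕-same _ ⟩
      vzero ∎)
      where
      open ≡-Reasoning
      x+z⊥y+w : x ⊕ z ⊥ y ⊕ w
      x+z⊥y+w = trans (B-⊕ˡ x z _) (cong₂ _xor_
        (trans (B-⊕ʳ x y w) (cong₂ _xor_ xy (⊥-sym wx)))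
        (trans (B-⊕ʳ z y w) (cong₂ _xor_ zy zw)))

    δ≡0 : ∀ x y → B x y ≡ true → δ x y ≡ vzero
    δ≡0 x y xy with common⊥ x y
    ... | z , z≢0 , zx , zy with nondegenerate z z≢0
    ...   | u , zu = radical-trivial (δ x y) λ v → ⊥-sym (subst (_⊥ δ x y) (A∘A⁻¹ v) (A⊥δ (A⁻¹ v)))
      where
      -- The projection makes u orthogonal to x and y and keeps its product 1 with z, as z is
      -- orthogonal to both; so (z , w) is a hyperbolic pair orthogonal to (x , y).
      w = project x y u
      δ≡ : δ x y ≡ δ z w
      δ≡ = δ-constant xy (trans (B-project u zx zy) zu) zx zy (project-⊥ˡ u xy) (project-⊥ʳ u xy)
      A⊥δ : ∀ v → A v ⊥ δ x y
      -- The part `v₀` in the span of x and y is orthogonal to z and w, so its image is orthogonal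
      -- to `δ z w`, which equals `δ x y`; the projected part is orthogonal to x and y directly.
      A⊥δ v = subst (_⊥ δ x y) (sym (trans (cong A (unproject x y v)) (additive⊥ _ _ split⊥)))
        (⊥-⊕ˡ (subst (A v₀ ⊥_) (sym δ≡) (⊥δ
                 (⊥-⊕ˡ (⊥-·ˡ (B v y) (⊥-sym zx)) (⊥-·ˡ (B v x) (⊥-sym zy)))
                 (⊥-⊕ˡ (⊥-·ˡ (B v y) (⊥-sym (project-⊥ˡ u xy))) (⊥-·ˡ (B v x) (⊥-sym (project-⊥ʳ u xy))))))
              (⊥δ (project-⊥ˡ v xy) (project-⊥ʳ v xy)))
        where
        v₀ = (B v y · x) ⊕ (B v x · y)
        split⊥ : v₀ ⊥ project x y v
        split⊥ = ⊥-⊕ˡ (⊥-·ˡ (B v y) (⊥-sym (project-⊥ˡ v xy))) (⊥-·ˡ (B v x) (⊥-sym (project-⊥ʳ v xy)))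

    A-additive : ∀ x y → A (x ⊕ y) ≡ A x ⊕ A y
    A-additive x y with B x y in xy
    ... | false = additive⊥ x y xy
    ... | true  = ⊕-cancel (δ≡0 x y xy)

    -- For B x y = 1, the hyperplane x^⊥ together with y spans; so A x ⊥ A y
    -- would put A x into the radical.
    A-preserves : ∀ x y → B (A x) (A y) ≡ B x y
    A-preserves x y with B x y in xy | B (A x) (A y) in AxAy
    ... | false | _     = trans (sym AxAy) (preserves⊥ x y xy)
    ... | true  | true  = refl
    ... | true  | false = contradiction (trans (sym xy) (trans (cong (λ v → B v y) x≡0) (B-vzeroˡ y))) λ ()
      where
      Ax⊥ : ∀ u → A x ⊥ A u
      Ax⊥ u with B x u in xu
      ... | false = preserves⊥ x u xu
      ... | true  = subst (A x ⊥_)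
        (trans (cong (_⊕ A y) (A-additive u y)) (⊕-twice (A u) (A y)))
        (⊥-⊕ʳ (preserves⊥ x (u ⊕ y) (trans (B-⊕ʳ x u y) (cong₂ _xor_ xu xy))) AxAy)
      Ax≡0 : A x ≡ vzero
      Ax≡0 = radical-trivial (A x) λ v → subst (A x ⊥_) (A∘A⁻¹ v) (Ax⊥ (A⁻¹ v))
      x≡0 : x ≡ vzero
      x≡0 = trans (sym (A⁻¹∘A x)) (trans (cong A⁻¹ (trans Ax≡0 (sym A-vzero))) (A⁻¹∘A vzero))

    A-isometry : Isometry A
    A-isometry = record { additive = A-additive ; preserves = A-preserves }

  -- The points (1, Q x, x) and the maps preserving their four-term relations

  module Lift (F : QuadraticForm S) where
    open QuadraticForm F

    -- The column at the point x of a parity check matrix of C*: overall parity, appended row,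
    -- Hamming rows.
    lift : BVec k → BVec (suc (suc k))
    lift x = true ∷ Q x ∷ x

    -- Four columns summing to zero form a word of weight four, or the zero word when points
    -- coincide; allowing coincidences spares side conditions of distinctness.
    PreservesPlanes : (BVec k → BVec k) → Set
    PreservesPlanes g = ∀ x y z w →
      (lift x ⊕ lift y) ⊕ (lift z ⊕ lift w) ≡ vzero →
      (lift (g x) ⊕ lift (g y)) ⊕ (lift (g z) ⊕ lift (g w)) ≡ vzero

    -- Each Q (x + t) contributes Q x + Q t + B x t. The four copies of Q t cancel, and the B terms
    -- add up to the product of t with a vanishing sum.
    translate-preservesPlanes : ∀ {g} t → PreservesPlanes g → PreservesPlanes (λ x → g x ⊕ t)
    translate-preservesPlanes {g} t planes x y z w eq with planes x y z w eq
    ... | eq′ = cong₂ (λ a v → false ∷ a ∷ v) Qsum vsum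
      where
      s = (g x ⊕ g y) ⊕ (g z ⊕ g w)
      s≡0 : s ≡ vzero
      s≡0 = cong (tail ∘ tail) eq′
      vsum : ((g x ⊕ t) ⊕ (g y ⊕ t)) ⊕ ((g z ⊕ t) ⊕ (g w ⊕ t)) ≡ vzero
      vsum = trans (⊕-solve (g x ∷ g y ∷ g z ∷ g w ∷ t ∷ [])
        (((# 0F ⊞ # 4F) ⊞ (# 1F ⊞ # 4F)) ⊞ ((# 2F ⊞ # 4F) ⊞ (# 3F ⊞ # 4F)))
        ((# 0F ⊞ # 1F) ⊞ (# 2F ⊞ # 3F)) refl) s≡0
      Bsum : (B (g x) t xor B (g y) t) xor (B (g z) t xor B (g w) t) ≡ false
      Bsum = trans (sym (trans (B-⊕ˡ _ _ t) (cong₂ _xor_ (B-⊕ˡ (g x) (g y) t) (B-⊕ˡ (g z) (g w) t))))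
                   (trans (cong (λ v → B v t) s≡0) (B-vzeroˡ t))
      Qsum : (Q (g x ⊕ t) xor Q (g y ⊕ t)) xor (Q (g z ⊕ t) xor Q (g w ⊕ t)) ≡ false
      Qsum = trans
        (cong₂ _xor_ (cong₂ _xor_ (Q-⊕ (g x) t) (Q-⊕ (g y) t)) (cong₂ _xor_ (Q-⊕ (g z) t) (Q-⊕ (g w) t)))
        (trans (rearrange (Q t) (Q (g x)) (Q (g y)) (Q (g z)) (Q (g w)) (B (g x) t) (B (g y) t) (B (g z) t) (B (g w) t))
          (cong₂ _xor_ (cong (head ∘ tail) eq′) Bsum))
        where
        rearrange : ∀ q a b c d a′ b′ c′ d′ →
          (((a xor q) xor a′) xor ((b xor q) xor b′)) xor (((c xor q) xor c′) xor ((d xor q) xor d′))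
          ≡ ((a xor b) xor (c xor d)) xor ((a′ xor b′) xor (c′ xor d′))
        rearrange = truthTable 9
          (λ q a b c d a′ b′ c′ d′ →
            (((a xor q) xor a′) xor ((b xor q) xor b′)) xor (((c xor q) xor c′) xor ((d xor q) xor d′)))
          (λ q a b c d a′ b′ c′ d′ →
            ((a xor b) xor (c xor d)) xor ((a′ xor b′) xor (c′ xor d′))) refl

    preservesPlanes⇒affineIsometry :
      (∀ x y → ∃ λ z → z ≢ vzero × z ⊥ x × z ⊥ y) →
      ∀ {g h} → (∀ x → g (h x) ≡ x) → (∀ x → h (g x) ≡ x) →
      PreservesPlanes g → AffineIsometry g
    preservesPlanes⇒affineIsometry common⊥ {g} {h} gh hg g-planes = record
      { linear = A ; translation = t
      ; isometry = OrthogonallyAdditive.A-isometry A (λ x → h (x ⊕ t))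
          (λ x → trans (cong (_⊕ t) (gh (x ⊕ t))) (⊕-twice x t))
          (λ x → trans (cong h (⊕-twice (g x) t)) (hg x))
          A-vzero (λ x y → proj₁ ∘ orthogonal x y) (λ x y → proj₂ ∘ orthogonal x y) common⊥
      ; affine = λ x → sym (⊕-twice (g x) t) }
      where
      t = g vzero
      A : BVec k → BVec k
      A x = g x ⊕ t
      A-vzero : A vzero ≡ vzero
      A-vzero = ⊕-same t
      orthogonal : ∀ x y → x ⊥ y → (A (x ⊕ y) ≡ A x ⊕ A y) × (A x ⊥ A y)
      orthogonal x y xy = A+ , A⊥
        where
        open ≡-Reasoning
        xy-plane : (lift vzero ⊕ lift x) ⊕ (lift y ⊕ lift (x ⊕ y)) ≡ vzero
        xy-plane = cong₂ (λ a v → false ∷ a ∷ v)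
          (begin
            (Q vzero xor Q x) xor (Q y xor Q (x ⊕ y))
              ≡⟨ cong₂ (λ a b → (a xor Q x) xor (Q y xor b)) Q-vzero (trans (Q-⊕ x y) (cong ((Q x xor Q y) xor_) xy)) ⟩
            (false xor Q x) xor (Q y xor ((Q x xor Q y) xor false))
              ≡⟨ truthTable 2 (λ a b → a xor (b xor ((a xor b) xor false))) (λ _ _ → false) refl (Q x) (Q y) ⟩
            false ∎)
          (⊕-solve (x ∷ y ∷ []) ((`0 ⊞ # 0F) ⊞ (# 1F ⊞ (# 0F ⊞ # 1F))) `0 refl)
        -- The vector component of this relation gives `A+`; its Q component, read with the help of
        -- `A+`, gives `A⊥`.
        image = translate-preservesPlanes t g-planes vzero x y (x ⊕ y) xy-plane
        A+ : A (x ⊕ y) ≡ A x ⊕ A y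
        A+ = ⊕-cancel (trans
          (⊕-solve (A (x ⊕ y) ∷ A x ∷ A y ∷ []) (# 0F ⊞ (# 1F ⊞ # 2F)) ((`0 ⊞ # 1F) ⊞ (# 2F ⊞ # 0F)) refl)
          (trans (cong (λ v → (v ⊕ A x) ⊕ (A y ⊕ A (x ⊕ y))) (sym A-vzero))
                 (cong (tail ∘ tail) image)))
        A⊥ : A x ⊥ A y
        A⊥ = begin
          B (A x) (A y)
            ≡⟨ truthTable 3 (λ a b c → c) (λ a b c → (false xor a) xor (b xor ((a xor b) xor c))) refl
                 (Q (A x)) (Q (A y)) _ ⟩
          (false xor Q (A x)) xor (Q (A y) xor ((Q (A x) xor Q (A y)) xor B (A x) (A y)))
            ≡⟨ cong₂ (λ a b → (a xor Q (A x)) xor (Q (A y) xor b))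
                 (sym (trans (cong Q A-vzero) Q-vzero)) (sym (trans (cong Q A+) (Q-⊕ (A x) (A y)))) ⟩
          (Q (A vzero) xor Q (A x)) xor (Q (A y) xor Q (A (x ⊕ y)))
            ≡⟨ cong (head ∘ tail) image ⟩
          false ∎

    -- An affine isometry g extends along lift to a linear map, because
    -- Q ∘ g and Q differ by an affine function.
    affineIsometry-lift : ∀ {g} → AffineIsometry g →
      ∃ λ L → (∀ u v → L (u ⊕ v) ≡ L u ⊕ L v) × (∀ x → L (lift x) ≡ lift (g x))
    affineIsometry-lift {g} G = L , L-additive , L-lift
      where
      open AffineIsometry G renaming (linear to A; translation to t)
      -- The difference of Q ∘ g and Q without its constant term Q t. In `L` the leading coordinate,
      -- equal to 1 on every lifted point, carries the constants Q t and t.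
      ℓ : BVec k → Bool
      ℓ x = (Q (A x) xor Q x) xor B (A x) t
      ℓ-additive : ∀ x y → ℓ (x ⊕ y) ≡ ℓ x xor ℓ y
      ℓ-additive x y = trans
        (cong₂ _xor_ (cong₂ _xor_
            (trans (cong Q (additive x y)) (trans (Q-⊕ (A x) (A y)) (cong ((Q (A x) xor Q (A y)) xor_) (preserves x y))))
            (Q-⊕ x y))
          (trans (cong (λ v → B v t) (additive x y)) (B-⊕ˡ (A x) (A y) t)))
        (truthTable 7
          (λ a b c d e p q → (((a xor b) xor e) xor ((c xor d) xor e)) xor (p xor q))
          (λ a b c d e p q → ((a xor c) xor p) xor ((b xor d) xor q)) refl
          (Q (A x)) (Q (A y)) (Q x) (Q y) (B x y) (B (A x) t) (B (A y) t))
      L : BVec (suc (suc k)) → BVec (suc (suc k))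
      L (a ∷ b ∷ x) = a ∷ (b xor (ℓ x xor (a ∧ Q t))) ∷ (A x ⊕ (a · t))
      L-additive : ∀ u v → L (u ⊕ v) ≡ L u ⊕ L v
      L-additive (a ∷ b ∷ x) (c ∷ d ∷ y) = cong₂ (λ e v → (a xor c) ∷ e ∷ v)
        (trans (cong (λ e → (b xor d) xor (e xor ((a xor c) ∧ Q t))) (ℓ-additive x y))
          (truthTable 7
            (λ a b c d p q s → (b xor d) xor ((p xor q) xor ((a xor c) ∧ s)))
            (λ a b c d p q s → (b xor (p xor (a ∧ s))) xor (d xor (q xor (c ∧ s)))) refl
            a b c d (ℓ x) (ℓ y) (Q t)))
        (trans (cong₂ _⊕_ (additive x y) (·-⊕ a c t)) (⊕-interchange (A x) (A y) _ _))
      L-lift : ∀ x → L (lift x) ≡ lift (g x)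
      L-lift x = cong₂ (λ e v → true ∷ e ∷ v)
        (sym (trans (cong Q (affine x)) (trans (Q-⊕ (A x) t)
          (truthTable 4 (λ a b c d → (a xor b) xor c) (λ a b c d → d xor (((a xor d) xor c) xor b)) refl
            (Q (A x)) (Q t) (B (A x) t) (Q x)))))
        (sym (affine x))

-- Lists without repetitions

unique-⊆-length : ∀ {A : Set} {xs ys : List A} → Unique xs → (∀ {x} → x ∈ xs → x ∈ ys) →
                  length xs ≤ length ys
unique-⊆-length {xs = []} _ _ = z≤n
unique-⊆-length {xs = x ∷ xs} (x≢xs ∷ xs!) sub with ∈-∃++ (sub (here refl))
... | as , bs , refl = subst (suc (length xs) ≤_) (sym (List.length-++-sucʳ as x bs))
  (s≤s (unique-⊆-length xs! avoid))
  where
  avoid : ∀ {y} → y ∈ xs → y ∈ as ++ bs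
  avoid {y} y∈xs with ∈-++⁻ as (sub (there y∈xs))
  ... | inj₁ y∈as         = ∈-++⁺ˡ y∈as
  ... | inj₂ (here y≡x)   = contradiction (sym y≡x) (All.lookup x≢xs y∈xs)
  ... | inj₂ (there y∈bs) = ∈-++⁺ʳ as y∈bs

unique-concatMap : ∀ {A C : Set} {f : A → List C} {xs} → Unique xs → (∀ x → x ∈ xs → Unique (f x)) →
                   (∀ {x y z} → z ∈ f x → z ∈ f y → x ≡ y) → Unique (concatMap f xs)
unique-concatMap {xs = []} _ _ _ = []
unique-concatMap {f = f} {x ∷ xs} (x≢xs ∷ xs!) f! disjoint =
  Unique.++⁺ (f! x (here refl)) (unique-concatMap xs! (λ y y∈ → f! y (there y∈)) disjoint)
    λ { (z∈fx , z∈rest) → apart z∈fx (find (∈-concatMap⁻ f z∈rest)) }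
  where
  apart : ∀ {z} → z ∈ f x → ¬ (∃ λ y → y ∈ xs × z ∈ f y)
  apart z∈fx (y , y∈xs , z∈fy) = All.lookup x≢xs y∈xs (disjoint z∈fx z∈fy)

length-concatMap : ∀ {A C : Set} (f : A → List C) c xs → (∀ x → x ∈ xs → length (f x) ≡ c) →
                   length (concatMap f xs) ≡ length xs * c
length-concatMap f c []       _  = refl
length-concatMap f c (x ∷ xs) fc = trans (List.length-++ (f x))
  (cong₂ _+_ (fc x (here refl)) (length-concatMap f c xs (λ y y∈ → fc y (there y∈))))

length-filter-split : ∀ {A : Set} (φ : A → Bool) xs →
  length (filter (λ x → φ x Bool.≟ true) xs) + length (filter (λ x → φ x Bool.≟ false) xs) ≡ length xs
length-filter-split φ []       = refl
length-filter-split φ (x ∷ xs) with φ x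
... | true  = cong suc (length-filter-split φ xs)
... | false = trans (ℕ.+-suc _ _) (cong suc (length-filter-split φ xs))

length-remove : ∀ {k} {x : BVec k} {xs} → Unique xs → x ∈ xs →
                suc (length (filter (λ y → ¬? (y ≟ᵥ x)) xs)) ≡ length xs
length-remove {x = x} {y ∷ xs} (y≢xs ∷ xs!) x∈ with y ≟ᵥ x
... | yes refl = cong (suc ∘ length)
                   (List.filter-all (λ z → ¬? (z ≟ᵥ x)) (All.map (λ y≢z z≡y → y≢z (sym z≡y)) y≢xs))
... | no  y≢x with x∈
...   | here x≡y   = contradiction (sym x≡y) y≢x
...   | there x∈xs = cong suc (length-remove xs! x∈xs)

length-one : ∀ {A : Set} {xs : List A} {x y} → length xs ≡ 1 → x ∈ xs → y ∈ xs → x ≡ y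
length-one {xs = _ ∷ []} _ (here refl) (here refl) = refl

double-injective : ∀ {a b} → a + a ≡ b + b → a ≡ b
double-injective {a} {b} eq = ℕ.*-cancelˡ-≡ a b 2
  (trans (cong (a +_) (ℕ.+-identityʳ a)) (trans eq (sym (cong (b +_) (ℕ.+-identityʳ b)))))

half : ∀ {a b e} → a ≡ b → a + b ≡ 2 ^ suc e → b ≡ 2 ^ e
half {e = e} refl eq = double-injective (trans eq (cong (2 ^ e +_) (ℕ.+-identityʳ (2 ^ e))))

factor-even : ∀ j → factor (suc j * 2) ≡ 2 ^ (suc j * 2) ∸ 1
factor-even j = cong (λ r → if r ≡ᵇ 0 then 2 ^ (suc j * 2) ∸ 1 else 2 ^ (suc j * 2)) (m*n%n≡0 (suc j) 2)

factor-odd : ∀ j → factor (suc (j * 2)) ≡ 2 ^ suc (j * 2)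
factor-odd j = cong (λ r → if r ≡ᵇ 0 then 2 ^ suc (j * 2) ∸ 1 else 2 ^ suc (j * 2)) ([m+kn]%n≡m%n 1 j 2)

-- Two consecutive factors together give the number of hyperbolic pairs in the even dimension at
-- hand, matching the recursion that removes one pair at a time.
ordProd-step : ∀ j → ordProd (suc j * 2) ≡ (2 ^ (suc j * 2) ∸ 1) * 2 ^ suc (j * 2) * ordProd (j * 2)
ordProd-step j = trans (cong₂ (λ a b → a * (b * ordProd (j * 2))) (factor-even j) (factor-odd j))
                       (sym (ℕ.*-assoc (2 ^ (suc j * 2) ∸ 1) (2 ^ suc (j * 2)) (ordProd (j * 2))))

ordProd>0 : ∀ j → 0 < ordProd (j * 2)
ordProd>0 zero    = s≤s z≤n
ordProd>0 (suc j) = subst (0 <_) (sym (ordProd-step j))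
  (ℕ.*-mono-≤ (ℕ.*-mono-≤ (ℕ.m<n⇒0<n∸m (ℕ.^-monoʳ-< 2 (s≤s (s≤s z≤n)) {0} {suc j * 2} (s≤s z≤n)))
                          (ℕ.m^n>0 2 (suc (j * 2))))
              (ordProd>0 j))

-- Hyperbolic sequences: their number, and the isometries between them

module HyperbolicSequences {k : ℕ} (S : SymplecticForm k) where
  open SymplecticForm S
  open Isometries S

  record Subspace (W : List (BVec k)) : Set where
    field
      vzero∈ : vzero ∈ W
      ⊕-∈    : ∀ {x y} → x ∈ W → y ∈ W → x ⊕ y ∈ W

    ·-∈ : ∀ b {x} → x ∈ W → b · x ∈ W
    ·-∈ true  x∈W = x∈W
    ·-∈ false _   = vzero∈

  -- A subspace over F₂ with 2ᵈ elements has dimension d, so cutting by a linear condition is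
  -- tracked by halving the list.
  record Dimension (W : List (BVec k)) (d : ℕ) : Set where
    field
      subspace : Subspace W
      unique   : Unique W
      size     : length W ≡ 2 ^ d
    open Subspace subspace public

  level : BVec k → Bool → List (BVec k) → List (BVec k)
  level u b = filter (λ w → B u w Bool.≟ b)

  ∈-level⁻ : ∀ {u b w} W → w ∈ level u b W → w ∈ W × B u w ≡ b
  ∈-level⁻ {u} {b} W = ∈-filter⁻ (λ w → B u w Bool.≟ b)

  ∈-level⁺ : ∀ {u b w W} → w ∈ W → B u w ≡ b → w ∈ level u b W
  ∈-level⁺ {u} {b} = ∈-filter⁺ (λ w → B u w Bool.≟ b)

  hyperplane-subspace : ∀ {W} u → Subspace W → Subspace (level u false W)
  hyperplane-subspace {W} u sub = record
    { vzero∈ = ∈-level⁺ vzero∈ (B-vzeroʳ u)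
    ; ⊕-∈ = λ x∈ y∈ → let x∈W , ux = ∈-level⁻ W x∈ ; y∈W , uy = ∈-level⁻ W y∈ in
        ∈-level⁺ (⊕-∈ x∈W y∈W) (⊥-⊕ʳ ux uy) }
    where open Subspace sub

  -- Translation by w₀ exchanges the two levels of B u.
  level-length : ∀ {W d u w₀} → Dimension W (suc d) → w₀ ∈ W → B u w₀ ≡ true →
                 length (level u true W) ≡ 2 ^ d × length (level u false W) ≡ 2 ^ d
  level-length {W} {d} {u} {w₀} dim w₀∈W uw₀ = trans equal false-length , false-length
    where
    open Dimension dim
    ≤-swap : ∀ b → length (level u b W) ≤ length (level u (true xor b) W)
    ≤-swap b = subst (_≤ _) (List.length-map (w₀ ⊕_) (level u b W))
      (unique-⊆-length (Unique.map⁺ cancel (Unique.filter⁺ _ unique)) swap∈)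
      where
      cancel : ∀ {x y} → w₀ ⊕ x ≡ w₀ ⊕ y → x ≡ y
      cancel {x} {y} eq = trans (⊕-solve (w₀ ∷ x ∷ []) (# 1F) (# 0F ⊞ (# 0F ⊞ # 1F)) refl)
        (trans (cong (w₀ ⊕_) eq) (⊕-solve (w₀ ∷ y ∷ []) (# 0F ⊞ (# 0F ⊞ # 1F)) (# 1F) refl))
      swap∈ : ∀ {x} → x ∈ List.map (w₀ ⊕_) (level u b W) → x ∈ level u (true xor b) W
      swap∈ x∈ with ∈-map⁻ (w₀ ⊕_) x∈
      ... | y , y∈ , refl with ∈-level⁻ W y∈
      ...   | y∈W , uy = ∈-level⁺ (⊕-∈ w₀∈W y∈W) (trans (B-⊕ʳ u w₀ y) (cong₂ _xor_ uw₀ uy))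
    equal : length (level u true W) ≡ length (level u false W)
    equal = ℕ.≤-antisym (≤-swap true) (≤-swap false)
    false-length : length (level u false W) ≡ 2 ^ d
    false-length = half {e = d} equal (trans (length-filter-split (B u) W) size)

  hyperplane-dimension : ∀ {W d u w₀} → Dimension W (suc d) → w₀ ∈ W → B u w₀ ≡ true →
                         Dimension (level u false W) d
  hyperplane-dimension {u = u} dim w₀∈W uw₀ = record
    { subspace = hyperplane-subspace u subspace
    ; unique   = Unique.filter⁺ _ unique
    ; size     = proj₂ (level-length dim w₀∈W uw₀) }
    where open Dimension dim

  perp : BVec k × BVec k → List (BVec k) → List (BVec k)
  perp (u , v) W = level v false (level u false W)

  ∈-perp⁻ : ∀ {u v w} W → w ∈ perp (u , v) W → w ∈ W × u ⊥ w × v ⊥ w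
  ∈-perp⁻ {u} W w∈ = let w∈′ , vw = ∈-level⁻ (level u false W) w∈ ; w∈W , uw = ∈-level⁻ W w∈′ in w∈W , uw , vw

  ∈-perp⁺ : ∀ {u v w W} → w ∈ W → u ⊥ w → v ⊥ w → w ∈ perp (u , v) W
  ∈-perp⁺ w∈W uw vw = ∈-level⁺ (∈-level⁺ w∈W uw) vw

  perp-subspace : ∀ {W} uv → Subspace W → Subspace (perp uv W)
  perp-subspace (u , v) sub = hyperplane-subspace v (hyperplane-subspace u sub)

  perp-dimension : ∀ {W d u v} → Dimension W (suc (suc d)) → u ∈ W → v ∈ W → B u v ≡ true →
                   Dimension (perp (u , v) W) d
  -- The vector v shows that u cuts W properly. Inside that hyperplane u itself, which lies there
  -- since `B` is alternating, shows the same for v.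
  perp-dimension {u = u} {v} dim u∈W v∈W uv = hyperplane-dimension (hyperplane-dimension dim v∈W uv)
    (∈-level⁺ u∈W (B-alternating u)) (trans (B-comm v u) uv)

  Nondegenerate : List (BVec k) → Set
  Nondegenerate W = ∀ x → x ∈ W → x ≢ vzero → ∃ λ y → y ∈ W × B x y ≡ true

  project-∈ : ∀ {W u v w} → Subspace W → u ∈ W → v ∈ W → B u v ≡ true → w ∈ W →
              project u v w ∈ perp (u , v) W
  project-∈ {u = u} {v} {w} sub u∈W v∈W uv w∈W = ∈-perp⁺
    (⊕-∈ w∈W (⊕-∈ (·-∈ (B w v) u∈W) (·-∈ (B w u) v∈W)))
    (⊥-sym (project-⊥ˡ w uv)) (⊥-sym (project-⊥ʳ w uv))
    where open Subspace sub

  -- The witness found in W is projected off the pair; x is orthogonal to the pair, so its product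
  -- with the witness does not change.
  perp-nondegenerate : ∀ {W u v} → Subspace W → u ∈ W → v ∈ W → B u v ≡ true →
                       Nondegenerate W → Nondegenerate (perp (u , v) W)
  perp-nondegenerate {W} {u} {v} sub u∈W v∈W uv nondeg x x∈ x≢0 with ∈-perp⁻ W x∈
  ... | x∈W , ux , vx with nondeg x x∈W x≢0
  ...   | y , y∈W , xy = project u v y , project-∈ sub u∈W v∈W uv y∈W ,
                         trans (B-project y (⊥-sym ux) (⊥-sym vx)) xy

  nonzero : List (BVec k) → List (BVec k)
  nonzero = filter (λ x → ¬? (x ≟ᵥ vzero))

  partners : List (BVec k) → BVec k → List (BVec k × BVec k)
  partners W u = List.map (u ,_) (level u true W)

  pairs : List (BVec k) → List (BVec k × BVec k)
  pairs W = concatMap (partners W) (nonzero W)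

  ∈-partners⁻ : ∀ W {u′ u v} → (u , v) ∈ partners W u′ → u ≡ u′ × v ∈ W × B u v ≡ true
  ∈-partners⁻ W {u′} uv∈ with ∈-map⁻ (u′ ,_) uv∈
  ... | v , v∈ , refl with ∈-level⁻ W v∈
  ...   | v∈W , uv = refl , v∈W , uv

  ∈-pairs⁻ : ∀ {W u v} → (u , v) ∈ pairs W → u ∈ W × v ∈ W × B u v ≡ true
  ∈-pairs⁻ {W} uv∈ with find (∈-concatMap⁻ (partners W) uv∈)
  ... | u′ , u′∈ , uv∈′ with ∈-partners⁻ W uv∈′
  ...   | refl , v∈W , uv = proj₁ (∈-filter⁻ (λ x → ¬? (x ≟ᵥ vzero)) u′∈) , v∈W , uv

  ∈-pairs⁺ : ∀ {W u v} → u ∈ W → v ∈ W → B u v ≡ true → (u , v) ∈ pairs W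
  ∈-pairs⁺ {W} {u} {v} u∈W v∈W uv = ∈-concatMap⁺ (partners W)
    (lose (∈-filter⁺ (λ x → ¬? (x ≟ᵥ vzero)) u∈W u≢0) (∈-map⁺ (u ,_) (∈-level⁺ v∈W uv)))
    where
    u≢0 : u ≢ vzero
    u≢0 refl = contradiction (trans (sym uv) (B-vzeroˡ v)) λ ()

  pairs-unique : ∀ {W} → Unique W → Unique (pairs W)
  pairs-unique {W} W! = unique-concatMap (Unique.filter⁺ _ W!)
    (λ u _ → Unique.map⁺ (cong proj₂) (Unique.filter⁺ _ W!))
    (λ z∈ z∈′ → trans (sym (proj₁ (∈-partners⁻ W z∈))) (proj₁ (∈-partners⁻ W z∈′)))

  pairs-length : ∀ {W d} → Dimension W (suc d) → Nondegenerate W →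
                 length (pairs W) ≡ (2 ^ suc d ∸ 1) * 2 ^ d
  pairs-length {W} {d} dim nondeg = trans
    (length-concatMap (partners W) (2 ^ d) (nonzero W) partners-length)
    (cong (λ n → (n ∸ 1) * 2 ^ d) (trans (length-remove unique vzero∈) size))
    where
    open Dimension dim
    partners-length : ∀ u → u ∈ nonzero W → length (partners W u) ≡ 2 ^ d
    partners-length u u∈ with ∈-filter⁻ (λ x → ¬? (x ≟ᵥ vzero)) u∈
    ... | u∈W , u≢0 with nondeg u u∈W u≢0
    ...   | v , v∈W , uv = trans (List.length-map (u ,_) (level u true W)) (proj₁ (level-length dim v∈W uv))

  Pairs : ℕ → Set
  Pairs = Vec (BVec k × BVec k)

  Hyperbolic : ∀ {j} → List (BVec k) → Pairs j → Set
  Hyperbolic W []            = ⊤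
  Hyperbolic W ((u , v) ∷ s) = (u ∈ W × v ∈ W × B u v ≡ true) × Hyperbolic (perp (u , v) W) s

  sequences : ∀ j → List (BVec k) → List (Pairs j)
  sequences zero    W = [] ∷ []
  sequences (suc j) W = concatMap (λ uv → List.map (uv ∷_) (sequences j (perp uv W))) (pairs W)

  ∈-sequences⁻ : ∀ j {W s} → s ∈ sequences j W → Hyperbolic W s
  ∈-sequences⁻ zero    {s = []} _ = tt
  ∈-sequences⁻ (suc j) {W} s∈
    with find (∈-concatMap⁻ (λ uv → List.map (uv ∷_) (sequences j (perp uv W))) {xs = pairs W} s∈)
  ... | uv , uv∈ , s∈′ with ∈-map⁻ (uv ∷_) s∈′
  ...   | s , s∈″ , refl = ∈-pairs⁻ uv∈ , ∈-sequences⁻ j s∈″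

  ∈-sequences⁺ : ∀ {j W} (s : Pairs j) → Hyperbolic W s → s ∈ sequences j W
  ∈-sequences⁺ []            _ = here refl
  ∈-sequences⁺ {suc j} {W} (uv ∷ s) ((u∈W , v∈W , uv≡1) , rest) =
    ∈-concatMap⁺ (λ uv → List.map (uv ∷_) (sequences j (perp uv W))) {xs = pairs W}
      (lose (∈-pairs⁺ u∈W v∈W uv≡1) (∈-map⁺ (uv ∷_) (∈-sequences⁺ s rest)))

  sequences-unique : ∀ j {W} → Unique W → Unique (sequences j W)
  sequences-unique zero    _  = [] ∷ []
  sequences-unique (suc j) {W} W! = unique-concatMap (pairs-unique W!)
    (λ uv _ → Unique.map⁺ (proj₂ ∘ Vec.∷-injective) (sequences-unique j (Unique.filter⁺ _ (Unique.filter⁺ _ W!))))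
    (λ z∈ z∈′ → same-head (∈-map⁻ _ z∈) (∈-map⁻ _ z∈′))
    where
    same-head : ∀ {uv uv′ : BVec k × BVec k} {z : Pairs (suc j)} {L L′ : List (Pairs j)} →
                (∃ λ s → s ∈ L × z ≡ uv ∷ s) → (∃ λ s → s ∈ L′ × z ≡ uv′ ∷ s) → uv ≡ uv′
    same-head (_ , _ , eq) (_ , _ , eq′) = proj₁ (Vec.∷-injective (trans (sym eq) eq′))

  sequences-length : ∀ j {W} → Dimension W (j * 2) → Nondegenerate W →
                     length (sequences j W) ≡ ordProd (j * 2)
  sequences-length zero    _   _      = refl
  sequences-length (suc j) {W} dim nondeg = trans
    (length-concatMap _ (ordProd (j * 2)) (pairs W) λ uv uv∈ →
     trans (List.length-map (uv ∷_) (sequences j (perp uv W)))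
      (let u∈W , v∈W , uv≡1 = ∈-pairs⁻ uv∈ in
       sequences-length j (perp-dimension dim u∈W v∈W uv≡1)
                          (perp-nondegenerate (Dimension.subspace dim) u∈W v∈W uv≡1 nondeg)))
    (trans (cong (_* ordProd (j * 2)) (pairs-length dim nondeg)) (sym (ordProd-step j)))

  -- The linear map sending the hyperbolic sequence in the first argument to
  -- the second one.
  extend : ∀ {j} → Pairs j → Pairs j → BVec k → BVec k
  extend []             []             x = vzero
  extend ((e , f) ∷ es) ((u , v) ∷ us) x = ((B x f · u) ⊕ (B x e · v)) ⊕ extend es us x

  extend-additive : ∀ {j} (es us : Pairs j) x y → extend es us (x ⊕ y) ≡ extend es us x ⊕ extend es us y
  extend-additive []             []             x y = sym (⊕-identityˡ vzero)
  extend-additive ((e , f) ∷ es) ((u , v) ∷ us) x y = trans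
    (cong₂ _⊕_
      (trans (cong₂ _⊕_ (trans (cong (_· u) (B-⊕ˡ x y f)) (·-⊕ (B x f) (B y f) u))
                        (trans (cong (_· v) (B-⊕ˡ x y e)) (·-⊕ (B x e) (B y e) v)))
             (⊕-interchange (B x f · u) (B y f · u) (B x e · v) (B y e · v)))
      (extend-additive es us x y))
    (⊕-interchange ((B x f · u) ⊕ (B x e · v)) ((B y f · u) ⊕ (B y e · v)) _ _)

  extend-∈ : ∀ {j W} (es us : Pairs j) x → Subspace W → Hyperbolic W us → extend es us x ∈ W
  extend-∈ []             []              x sub _ = Subspace.vzero∈ sub
  extend-∈ {W = W} ((e , f) ∷ es) (uv ∷ us) x sub ((u∈W , v∈W , _) , rest) =
    ⊕-∈ (⊕-∈ (·-∈ (B x f) u∈W) (·-∈ (B x e) v∈W))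
        (proj₁ (∈-perp⁻ W (extend-∈ es us x (perp-subspace uv sub) rest)))
    where open Subspace sub

  extend-⊥ : ∀ {j W} (es us : Pairs j) z → Hyperbolic W es → (∀ w → w ∈ W → z ⊥ w) → extend es us z ≡ vzero
  extend-⊥ []             []             z _ _ = refl
  extend-⊥ {W = W} ((e , f) ∷ es) ((u , v) ∷ us) z ((e∈W , f∈W , _) , rest) z⊥W = trans
    (cong₂ _⊕_ (cong₂ (λ a b → (a · u) ⊕ (b · v)) (z⊥W f f∈W) (z⊥W e e∈W))
               (extend-⊥ es us z rest (λ w w∈ → z⊥W w (proj₁ (∈-perp⁻ W w∈)))))
    (⊕-solve [] ((`0 ⊞ `0) ⊞ `0) `0 refl)

  -- The form written in coordinates with respect to the sequence. The target of `extend` does not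
  -- occur in it, so every hyperbolic target yields the same value.
  gram : ∀ {j} → Pairs j → BVec k → BVec k → Bool
  gram []             x y = false
  gram ((e , f) ∷ es) x y = ((B x f ∧ B y e) xor (B x e ∧ B y f)) xor gram es x y

  -- The remainder of the sum stays in `perp (u , v) W`, hence is orthogonal to the part along u and
  -- v; the cross terms vanish and the form splits along the recursion.
  B-extend : ∀ {j W} (es us : Pairs j) x y → Subspace W → Hyperbolic W us →
             B (extend es us x) (extend es us y) ≡ gram es x y
  B-extend []             []             x y _ _ = B-vzeroˡ vzero
  B-extend {W = W} ((e , f) ∷ es) ((u , v) ∷ us) x y sub ((u∈W , v∈W , uv) , rest) = begin
    B (p ⊕ r) (p′ ⊕ r′)
      ≡⟨ trans (B-⊕ˡ p r _) (cong₂ _xor_ (B-⊕ʳ p p′ r′) (B-⊕ʳ r p′ r′)) ⟩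
    (B p p′ xor B p r′) xor (B r p′ xor B r r′)
      ≡⟨ cong₂ (λ a b → (B p p′ xor a) xor (b xor B r r′)) (p⊥ (x , r′∈)) (⊥-sym (p⊥ (y , r∈))) ⟩
    (B p p′ xor false) xor B r r′
      ≡⟨ cong₂ _xor_ (trans (Bool.xor-identityʳ (B p p′)) Bpp′) (B-extend es us x y (perp-subspace (u , v) sub) rest) ⟩
    ((B x f ∧ B y e) xor (B x e ∧ B y f)) xor gram es x y ∎
    where
    open ≡-Reasoning
    part : BVec k → BVec k
    part z = (B z f · u) ⊕ (B z e · v)
    p p′ r r′ : BVec k
    p  = part x
    p′ = part y
    r  = extend es us x
    r′ = extend es us y
    r∈ : r ∈ perp (u , v) W
    r∈ = extend-∈ es us x (perp-subspace (u , v) sub) rest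
    r′∈ : r′ ∈ perp (u , v) W
    r′∈ = extend-∈ es us y (perp-subspace (u , v) sub) rest
    p⊥ : ∀ {w} → (∃ λ z → w ∈ perp (u , v) W) → ∀ {z} → part z ⊥ w
    p⊥ (_ , w∈) {z} = let _ , uw , vw = ∈-perp⁻ W w∈ in ⊥-⊕ˡ (⊥-·ˡ (B z f) uw) (⊥-·ˡ (B z e) vw)
    B-· : ∀ a b w w′ → B (a · w) (b · w′) ≡ a ∧ (b ∧ B w w′)
    B-· a b w w′ = trans (B-·ˡ a w _) (cong (a ∧_) (B-·ʳ b w w′))
    Bpp′ : B p p′ ≡ (B x f ∧ B y e) xor (B x e ∧ B y f)
    Bpp′ = trans (trans (B-⊕ˡ (B x f · u) (B x e · v) p′)
        (cong₂ _xor_ (B-⊕ʳ _ (B y f · u) (B y e · v)) (B-⊕ʳ _ (B y f · u) (B y e · v))))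
      (trans (cong₂ _xor_
        (cong₂ _xor_ (trans (B-· (B x f) (B y f) u u) (cong (λ c → B x f ∧ (B y f ∧ c)) (B-alternating u)))
                     (trans (B-· (B x f) (B y e) u v) (cong (λ c → B x f ∧ (B y e ∧ c)) uv)))
        (cong₂ _xor_ (trans (B-· (B x e) (B y f) v u) (cong (λ c → B x e ∧ (B y f ∧ c)) (trans (B-comm v u) uv)))
                     (trans (B-· (B x e) (B y e) v v) (cong (λ c → B x e ∧ (B y e ∧ c)) (B-alternating v)))))
        (truthTable 4
          (λ a b c d → ((a ∧ (c ∧ false)) xor (a ∧ (d ∧ true))) xor ((b ∧ (c ∧ true)) xor (b ∧ (d ∧ false))))
          (λ a b c d → (a ∧ d) xor (b ∧ c)) refl (B x f) (B x e) (B y f) (B y e)))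

  -- Split x into its part along (e , f) and its projection: the extension along the rest kills the
  -- former and fixes the latter by induction. At the end a space with 2⁰ elements contains only 0.
  extend-identity : ∀ {j W} (es : Pairs j) → Dimension W (j * 2) → Hyperbolic W es →
                    ∀ {x} → x ∈ W → extend es es x ≡ x
  extend-identity [] dim _ x∈W = length-one (Dimension.size dim) (Dimension.vzero∈ dim) x∈W
  extend-identity {W = W} ((e , f) ∷ es) dim ((e∈W , f∈W , ef) , rest) {x} x∈W =
    trans (cong (x₀ ⊕_) (begin
      extend es es x                                  ≡⟨ cong (extend es es) (unproject e f x) ⟩
      extend es es (x₀ ⊕ project e f x)               ≡⟨ extend-additive es es x₀ _ ⟩
      extend es es x₀ ⊕ extend es es (project e f x)  ≡⟨ cong₂ _⊕_ (extend-⊥ es es x₀ rest x₀⊥)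
                                                           (extend-identity es (perp-dimension dim e∈W f∈W ef) rest
                                                             (project-∈ subspace e∈W f∈W ef x∈W)) ⟩
      vzero ⊕ project e f x                           ≡⟨ ⊕-identityˡ _ ⟩
      project e f x                                   ∎))
    (sym (unproject e f x))
    where
    open ≡-Reasoning
    open Dimension dim
    x₀ : BVec k
    x₀ = (B x f · e) ⊕ (B x e · f)
    x₀⊥ : ∀ w → w ∈ perp (e , f) W → x₀ ⊥ w
    x₀⊥ w w∈ = let _ , ew , fw = ∈-perp⁻ W w∈ in ⊥-⊕ˡ (⊥-·ˡ (B x f) ew) (⊥-·ˡ (B x e) fw)

  mapPairs : ∀ {j} → (BVec k → BVec k) → Pairs j → Pairs j
  mapPairs g = map λ { (u , v) → g u , g v }

  mapPairs-cong : ∀ {j W g h} (s : Pairs j) → Hyperbolic W s → (∀ {x} → x ∈ W → g x ≡ h x) →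
                  mapPairs g s ≡ mapPairs h s
  mapPairs-cong []            _ _ = refl
  mapPairs-cong {W = W} (_ ∷ s) ((u∈W , v∈W , _) , rest) gh = cong₂ _∷_
    (cong₂ _,_ (gh u∈W) (gh v∈W)) (mapPairs-cong s rest (gh ∘ proj₁ ∘ ∈-perp⁻ W))

  hyperbolic-map : ∀ {j W W′ A} (s : Pairs j) → Isometry A → (∀ {x} → x ∈ W → A x ∈ W′) →
                   Hyperbolic W s → Hyperbolic W′ (mapPairs A s)
  hyperbolic-map []            _   _  _ = tt
  hyperbolic-map {W = W} ((u , v) ∷ s) iso A∈ ((u∈W , v∈W , uv) , rest) =
    (A∈ u∈W , A∈ v∈W , trans (preserves u v) uv) ,
    hyperbolic-map s iso
      (λ x∈ → let x∈W , ux , vx = ∈-perp⁻ W x∈ in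
              ∈-perp⁺ (A∈ x∈W) (trans (preserves u _) ux) (trans (preserves v _) vx))
      rest
    where open Isometry iso

  extend-natural : ∀ {j A} (es us : Pairs j) x → Isometry A → A (extend es us x) ≡ extend es (mapPairs A us) x
  extend-natural []             []             x iso = Isometry.vzero-fixed iso
  extend-natural {A = A} ((e , f) ∷ es) ((u , v) ∷ us) x iso = trans (additive _ _)
    (cong₂ _⊕_ (trans (additive _ _) (cong₂ _⊕_ (A-· (B x f) u) (A-· (B x e) v)))
               (extend-natural es us x iso))
    where
    open Isometry iso
    A-· : ∀ b w → A (b · w) ≡ b · A w
    A-· true  w = refl
    A-· false w = vzero-fixed

  -- On the first pair, e has coordinates (1, 0) and f has (0, 1), and the later terms vanish on
  -- both. On the orthogonal complement the first pair contributes nothing, so induction applies.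
  -- Hence a linear map of this kind determines its target sequence.
  extend-basis : ∀ {j W} (es us : Pairs j) → Hyperbolic W es → mapPairs (extend es us) es ≡ us
  extend-basis []             []             _ = refl
  extend-basis {W = W} ((e , f) ∷ es) ((u , v) ∷ us) ((e∈W , f∈W , ef) , rest) = cong₂ _∷_
    (cong₂ _,_ at-e at-f)
    (trans (mapPairs-cong es rest on-perp) (extend-basis es us rest))
    where
    g = extend ((e , f) ∷ es) ((u , v) ∷ us)
    at-e : g e ≡ u
    at-e = trans (cong₂ _⊕_
        (cong₂ (λ a b → (a · u) ⊕ (b · v)) ef (B-alternating e))
        (extend-⊥ es us e rest (λ w w∈ → proj₁ (proj₂ (∈-perp⁻ W w∈)))))
      (⊕-solve (u ∷ []) ((# 0F ⊞ `0) ⊞ `0) (# 0F) refl)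
    at-f : g f ≡ v
    at-f = trans (cong₂ _⊕_
        (cong₂ (λ a b → (a · u) ⊕ (b · v)) (B-alternating f) (trans (B-comm f e) ef))
        (extend-⊥ es us f rest (λ w w∈ → proj₂ (proj₂ (∈-perp⁻ W w∈)))))
      (⊕-solve (v ∷ []) ((`0 ⊞ # 0F) ⊞ `0) (# 0F) refl)
    on-perp : ∀ {x} → x ∈ perp (e , f) W → g x ≡ extend es us x
    on-perp {x} x∈ = let _ , ex , fx = ∈-perp⁻ W x∈ in trans
      (cong (_⊕ extend es us x) (cong₂ (λ a b → (a · u) ⊕ (b · v)) (⊥-sym fx) (⊥-sym ex)))
      (⊕-solve (extend es us x ∷ []) ((`0 ⊞ `0) ⊞ # 0F) (# 0F) refl)

  -- Both sides equal `gram es x y`: the right one because `extend es es` is the identity.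
  extend-isometry : ∀ {j W} (es us : Pairs j) → Dimension W (j * 2) → (∀ x → x ∈ W) →
                    Hyperbolic W es → Hyperbolic W us → Isometry (extend es us)
  extend-isometry es us dim all es-hyp us-hyp = record
    { additive  = extend-additive es us
    ; preserves = λ x y → trans (B-extend es us x y subspace us-hyp)
        (trans (sym (B-extend es es x y subspace es-hyp))
               (cong₂ B (extend-identity es dim es-hyp (all x)) (extend-identity es dim es-hyp (all y)))) }
    where open Dimension dim

  isometry-extend : ∀ {j W A} (es : Pairs j) → Dimension W (j * 2) → (∀ x → x ∈ W) →
                    Hyperbolic W es → Isometry A → ∀ x → extend es (mapPairs A es) x ≡ A x
  isometry-extend {A = A} es dim all es-hyp iso x =
    trans (sym (extend-natural es es x iso)) (cong A (extend-identity es dim es-hyp (all x)))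

-- Permutations as vectors of indices

lookup-ext : ∀ {A : Set} {k} {u v : Vec A k} → (∀ i → lookup u i ≡ lookup v i) → u ≡ v
lookup-ext {u = u} {v} eq =
  trans (sym (Vec.tabulate∘lookup u)) (trans (Vec.tabulate-cong eq) (Vec.tabulate∘lookup v))

lookup-∘ₚ : ∀ {k} (σ τ : Perm k) i → lookup (σ ∘ₚ τ) i ≡ lookup σ (lookup τ i)
lookup-∘ₚ σ τ i = Vec.lookup-map i (lookup σ) τ

permute-∘ₚ : ∀ {k} (σ τ : Perm k) c → permute (σ ∘ₚ τ) c ≡ permute τ (permute σ c)
permute-∘ₚ σ τ c = trans (sym (Vec.map-∘ (lookup c) (lookup σ) τ))
  (Vec.map-cong (λ i → sym (Vec.lookup-map i (lookup c) σ)) τ)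

IsAut-∘ₚ : ∀ {k} {C : BVec k → Set} σ τ → IsAut C σ → IsAut C τ → IsAut C (σ ∘ₚ τ)
IsAut-∘ₚ {C = C} σ τ (σ-inj , σ-aut) (τ-inj , τ-aut) =
  (λ i j eq → τ-inj i j (σ-inj _ _ (trans (sym (lookup-∘ₚ σ τ i)) (trans eq (lookup-∘ₚ σ τ j))))) ,
  (λ c c∈ → subst C (sym (permute-∘ₚ σ τ c)) (τ-aut _ (σ-aut c c∈)))

IsAut-idₚ : ∀ {k} {C : BVec k → Set} → IsAut C idₚ
IsAut-idₚ {C = C} =
  (λ i j eq → trans (sym (Vec.lookup-allFin i)) (trans eq (Vec.lookup-allFin j))) ,
  (λ c → subst C (sym (Vec.map-lookup-allFin c)))

module Inverse {k : ℕ} (σ : Perm k) (σ-inj : IsPerm σ) where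

  inverse : Fin k → Fin k
  inverse i = proj₁ (injective⇒surjective (lookup σ) σ-inj i)

  lookup-inverse : ∀ i → lookup σ (inverse i) ≡ i
  lookup-inverse i = proj₂ (injective⇒surjective (lookup σ) σ-inj i)

  inverse-lookup : ∀ i → inverse (lookup σ i) ≡ i
  inverse-lookup i = σ-inj _ _ (lookup-inverse (lookup σ i))

  -- A reindexing of the sum of the columns weighted by c. It trades a permutation of words for the
  -- inverse permutation of columns.
  synd-permute : ∀ {m} (h : Fin k → BVec m) c →
                 synd (tabulate h) (permute σ c) ≡ synd (tabulate (h ∘ inverse)) c
  synd-permute {m} h c = begin
    synd (tabulate h) (permute σ c)                          ≡⟨ synd-sum h (permute σ c) ⟩
    Σ⊕ (λ i → lookup (permute σ c) i · h i)                  ≡⟨ sum-cong-≗ (⊕-commutativeMonoid m) (λ i →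
                                                                  cong₂ _·_ (Vec.lookup-map i (lookup c) σ)
                                                                            (cong h (sym (inverse-lookup i)))) ⟩
    Σ⊕ (λ i → summand (lookup σ i))                          ≡⟨ sum-permute (⊕-commutativeMonoid m) summand
                                                                  (permutation (lookup σ) inverse lookup-inverse inverse-lookup) ⟨
    Σ⊕ summand                                               ≡⟨ synd-sum (h ∘ inverse) c ⟨
    synd (tabulate (h ∘ inverse)) c                          ∎
    where
    open ≡-Reasoning
    Σ⊕ : ∀ {l} → (Fin l → BVec m) → BVec m
    Σ⊕ = sum (⊕-commutativeMonoid m)
    summand : Fin k → BVec m
    summand i = lookup c i · h (inverse i)
    synd-sum : ∀ {l} (h : Fin l → BVec m) c → synd (tabulate h) c ≡ Σ⊕ (λ i → lookup c i · h i)
    synd-sum h []      = refl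
    synd-sum h (b ∷ c) = cong ((b · h zero) ⊕_) (synd-sum (h ∘ suc) c)

  -- Parity is the syndrome for columns all equal to 1 in F₂¹, and a constant family of columns is
  -- unaffected by relabelling.
  parity-permute : ∀ c → parity (permute σ c) ≡ parity c
  parity-permute c = cong head
    (trans (sym (synd-parity (permute σ c))) (trans (synd-permute (λ _ → true ∷ []) c) (synd-parity c)))
    where
    synd-parity : ∀ {l} (c : BVec l) → synd (tabulate (λ _ → true ∷ [])) c ≡ parity c ∷ []
    synd-parity []          = refl
    synd-parity (true  ∷ c) = cong ((true ∷ []) ⊕_) (synd-parity c)
    synd-parity (false ∷ c) = cong ((false ∷ []) ⊕_) (synd-parity c)

synd-natural : ∀ {m m′} (L : BVec m → BVec m′) → (∀ u v → L (u ⊕ v) ≡ L u ⊕ L v) →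
               ∀ {l} (h : Fin l → BVec m) c → synd (tabulate (L ∘ h)) c ≡ L (synd (tabulate h) c)
synd-natural {m} L L-⊕ = go
  where
  L-vzero : L vzero ≡ vzero
  L-vzero = ⊕-idempotent (trans (sym (L-⊕ vzero vzero)) (cong L (⊕-same vzero)))
  L-· : ∀ b v → b · L v ≡ L (b · v)
  L-· true  v = refl
  L-· false v = sym L-vzero
  go : ∀ {l} (h : Fin l → BVec m) c → synd (tabulate (L ∘ h)) c ≡ L (synd (tabulate h) c)
  go h []      = sym L-vzero
  go h (b ∷ c) = trans (cong₂ _⊕_ (L-· b (h zero)) (go (h ∘ suc) c)) (sym (L-⊕ _ _))

synd-cong : ∀ {m l} {h h′ : Fin l → BVec m} → (∀ i → h i ≡ h′ i) → ∀ c →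
            synd (tabulate h) c ≡ synd (tabulate h′) c
synd-cong eq c = cong (λ hs → synd hs c) (Vec.tabulate-cong eq)

synd-units : ∀ {m l} (h : Fin l → BVec m) a b c d →
  synd (tabulate h) ((unit a ⊕ unit b) ⊕ (unit c ⊕ unit d)) ≡ (h a ⊕ h b) ⊕ (h c ⊕ h d)
synd-units h a b c d = trans (synd-⊕ hs (unit a ⊕ unit b) (unit c ⊕ unit d))
  (cong₂ _⊕_ (trans (synd-⊕ hs (unit a) (unit b)) (cong₂ _⊕_ (at a) (at b)))
             (trans (synd-⊕ hs (unit c) (unit d)) (cong₂ _⊕_ (at c) (at d))))
  where
  hs = tabulate h
  at : ∀ i → synd hs (unit i) ≡ h i
  at i = trans (synd-unit hs i) (Vec.lookup∘tabulate h i)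

-- The stabiliser of ∞ in Aut(C*) is Aut(C)

fix∞ : ∀ {k} → Perm k → Perm (suc k)
fix∞ σ = zero ∷ map suc σ

Stabiliser : ∀ {k} → (BVec k → Set) → Perm (suc k) → Set
Stabiliser C σ = IsAut (Ext C) σ × lookup σ zero ≡ zero

stabiliser≅ : ∀ {k} (C : BVec k → Set) → GroupIso (IsAut C) _∘ₚ_ (Stabiliser C) _∘ₚ_
stabiliser≅ {k} C = record
  { f    = fix∞
  ; pres = λ σ σ∈ → (fix∞-IsPerm σ (proj₁ σ∈) , fix∞-Ext σ σ∈) , refl
  ; hom  = λ σ τ _ _ → cong (zero ∷_) (trans (sym (Vec.map-∘ suc (lookup σ) τ))
      (trans (Vec.map-cong (λ i → sym (Vec.lookup-map i suc σ)) τ) (Vec.map-∘ (lookup (fix∞ σ)) suc τ)))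
  ; inj  = λ σ τ _ _ eq → lookup-ext λ i → Fin.suc-injective
      (trans (sym (Vec.lookup-map i suc σ))
        (trans (cong (λ ρ → lookup ρ (suc i)) eq) (Vec.lookup-map i suc τ)))
  ; surj = restrict
  }
  where
  fix∞-IsPerm : ∀ σ → IsPerm σ → IsPerm (fix∞ σ)
  fix∞-IsPerm σ σ-inj zero    zero    _  = refl
  fix∞-IsPerm σ σ-inj zero    (suc j) eq with () ← trans eq (Vec.lookup-map j suc σ)
  fix∞-IsPerm σ σ-inj (suc i) zero    eq with () ← trans (sym eq) (Vec.lookup-map i suc σ)
  fix∞-IsPerm σ σ-inj (suc i) (suc j) eq = cong suc (σ-inj i j (Fin.suc-injective
    (trans (sym (Vec.lookup-map i suc σ)) (trans eq (Vec.lookup-map j suc σ)))))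

  permute-fix∞ : ∀ σ x c → permute (fix∞ σ) (x ∷ c) ≡ x ∷ permute σ c
  permute-fix∞ σ x c = cong (x ∷_) (sym (Vec.map-∘ (lookup (x ∷ c)) suc σ))

  fix∞-Ext : ∀ σ → IsAut C σ → ∀ c → Ext C c → Ext C (permute (fix∞ σ) c)
  fix∞-Ext σ (σ-inj , σ-aut) (x ∷ c) (c∈ , x≡) = subst (Ext C) (sym (permute-fix∞ σ x c))
    (σ-aut c c∈ , trans x≡ (sym (Inverse.parity-permute σ σ-inj c)))

  restrict : ∀ τ → Stabiliser C τ → ∃ λ σ → IsAut C σ × fix∞ σ ≡ τ
  restrict (.zero ∷ ρ) ((τ-inj , τ-aut) , refl) = σ , (σ-inj , σ-aut) , fix∞σ≡τ
    where
    predecessor : ∀ i → ∃ λ j → lookup ρ i ≡ suc j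
    predecessor i with lookup ρ i in eq
    ... | suc j = j , refl
    ... | zero with () ← τ-inj zero (suc i) (sym eq)
    σ : Perm k
    σ = tabulate (proj₁ ∘ predecessor)
    suc-σ : ∀ i → suc (lookup σ i) ≡ lookup ρ i
    suc-σ i = trans (cong suc (Vec.lookup∘tabulate (proj₁ ∘ predecessor) i)) (sym (proj₂ (predecessor i)))
    fix∞σ≡τ : fix∞ σ ≡ zero ∷ ρ
    fix∞σ≡τ = cong (zero ∷_) (lookup-ext λ i → trans (Vec.lookup-map i suc σ) (suc-σ i))
    σ-inj : IsPerm σ
    σ-inj i j eq = Fin.suc-injective (τ-inj (suc i) (suc j)
      (trans (sym (suc-σ i)) (trans (cong suc eq) (suc-σ j))))
    σ-aut : ∀ c → C c → C (permute σ c)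
    -- Complete c by its parity to a word of the extension, apply the automorphism there, and drop
    -- the coordinate ∞.
    σ-aut c c∈ = proj₁ (subst (Ext C)
      (trans (cong (λ τ → permute τ (parity c ∷ c)) (sym fix∞σ≡τ)) (permute-fix∞ σ (parity c) c))
      (τ-aut (parity c ∷ c) (c∈ , refl)))

-- Coordinate permutations as maps of the vector space

record Enumeration (k n : ℕ) : Set where
  field
    E            : Fin (suc n) → BVec k
    E-zero       : E zero ≡ vzero
    E-injective  : ∀ i j → E i ≡ E j → i ≡ j
    E-surjective : ∀ x → ∃ λ i → E i ≡ x

  E⁻¹ : BVec k → Fin (suc n)
  E⁻¹ x = proj₁ (E-surjective x)

  E∘E⁻¹ : ∀ x → E (E⁻¹ x) ≡ x
  E∘E⁻¹ x = proj₂ (E-surjective x)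

  E⁻¹∘E : ∀ i → E⁻¹ (E i) ≡ i
  E⁻¹∘E i = E-injective _ _ (E∘E⁻¹ (E i))

  E⁻¹-vzero : E⁻¹ vzero ≡ zero
  E⁻¹-vzero = E-injective _ _ (trans (E∘E⁻¹ vzero) (sym E-zero))

  act : Perm (suc n) → BVec k → BVec k
  act σ x = E (lookup σ (E⁻¹ x))

  perm : (BVec k → BVec k) → Perm (suc n)
  perm g = tabulate (λ i → E⁻¹ (g (E i)))

  act-perm : ∀ g x → act (perm g) x ≡ g x
  act-perm g x = trans (cong E (Vec.lookup∘tabulate (λ i → E⁻¹ (g (E i))) (E⁻¹ x)))
    (trans (E∘E⁻¹ _) (cong g (E∘E⁻¹ x)))

  act-∘ₚ : ∀ σ τ x → act (σ ∘ₚ τ) x ≡ act σ (act τ x)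
  act-∘ₚ σ τ x = cong E (trans (lookup-∘ₚ σ τ (E⁻¹ x)) (cong (lookup σ) (sym (E⁻¹∘E _))))

  act-idₚ : ∀ x → act idₚ x ≡ x
  act-idₚ x = trans (cong E (Vec.lookup-allFin (E⁻¹ x))) (E∘E⁻¹ x)

  act-injective : ∀ {σ τ} → (∀ x → act σ x ≡ act τ x) → σ ≡ τ
  act-injective {σ} {τ} eq = lookup-ext λ i →
    subst (λ j → lookup σ j ≡ lookup τ j) (E⁻¹∘E i) (E-injective _ _ (eq (E i)))

  perm-IsPerm : ∀ g → (∀ x y → g x ≡ g y → x ≡ y) → IsPerm (perm g)
  perm-IsPerm g g-inj i j eq = E-injective i j (g-inj (E i) (E j)
    (trans (sym (E∘E⁻¹ _)) (trans (cong E (trans (sym (at i)) (trans eq (at j)))) (E∘E⁻¹ _))))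
    where
    at : ∀ i → lookup (perm g) i ≡ E⁻¹ (g (E i))
    at = Vec.lookup∘tabulate (λ i → E⁻¹ (g (E i)))

  act-vzero : ∀ σ → lookup σ zero ≡ zero → act σ vzero ≡ vzero
  act-vzero σ eq = trans (cong (E ∘ lookup σ) E⁻¹-vzero) (trans (cong E eq) E-zero)

  act-vzero⁻ : ∀ σ → act σ vzero ≡ vzero → lookup σ zero ≡ zero
  act-vzero⁻ σ eq = E-injective _ _
    (trans (cong (E ∘ lookup σ) (sym E⁻¹-vzero)) (trans eq (sym E-zero)))

-- The automorphism group as the group of affine isometries

module AutomorphismGroup {k n : ℕ} {S : SymplecticForm k} (F : QuadraticForm S)
  (enumeration : Enumeration k n) (C : BVec n → Set) where

  open SymplecticForm S
  open QuadraticForm F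
  open Isometries S
  open Lift F
  open Enumeration enumeration

  Word : BVec (suc n) → Set
  Word c = synd (tabulate (lift ∘ E)) c ≡ vzero

  Aut : Perm (suc n) → Set
  Aut = IsAut (Ext C)

  AffineIsometry-cong : ∀ {g h} → (∀ x → g x ≡ h x) → AffineIsometry g → AffineIsometry h
  AffineIsometry-cong gh G = record
    { linear = linear ; translation = translation ; isometry = isometry
    ; affine = λ x → trans (sym (gh x)) (affine x) }
    where open AffineIsometry G

  -- The code enters only through the last two hypotheses: its extension consists of the linear
  -- relations among the lifted points.
  module Characterisation
    (common⊥ : ∀ x y → ∃ λ z → z ≢ vzero × z ⊥ x × z ⊥ y)
    (ext⇒word : ∀ c → Ext C c → Word c) (word⇒ext : ∀ c → Word c → Ext C c) where

    module _ (σ : Perm (suc n)) (σ-inj : IsPerm σ) where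
      open Inverse σ σ-inj

      act⁻¹ : BVec k → BVec k
      act⁻¹ x = E (inverse (E⁻¹ x))

      act∘act⁻¹ : ∀ x → act σ (act⁻¹ x) ≡ x
      act∘act⁻¹ x = trans (cong (E ∘ lookup σ) (E⁻¹∘E _)) (trans (cong E (lookup-inverse _)) (E∘E⁻¹ x))

      act⁻¹∘act : ∀ x → act⁻¹ (act σ x) ≡ x
      act⁻¹∘act x = trans (cong (E ∘ inverse) (E⁻¹∘E _)) (trans (cong E (inverse-lookup _)) (E∘E⁻¹ x))

      syndrome-permute : ∀ c → synd (tabulate (lift ∘ E)) (permute σ c) ≡ synd (tabulate (lift ∘ act⁻¹ ∘ E)) c
      syndrome-permute c = trans (synd-permute (lift ∘ E) c)
        (synd-cong (λ i → cong (lift ∘ E ∘ inverse) (sym (E⁻¹∘E i))) c)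

      -- The columns move by the inverse map, again an affine isometry, and this extends to a linear
      -- L on lifted points. The syndrome of the permuted word is then L of the old one, which is L
      -- 0.
      affineIsometry⇒aut : AffineIsometry (act σ) → Aut σ
      affineIsometry⇒aut G with affineIsometry-lift (inverse-affineIsometry act∘act⁻¹ G)
      ... | L , L-⊕ , L-lift = σ-inj , λ c c∈ → word⇒ext _ (begin
        synd (tabulate (lift ∘ E)) (permute σ c)     ≡⟨ syndrome-permute c ⟩
        synd (tabulate (lift ∘ act⁻¹ ∘ E)) c         ≡⟨ synd-cong (λ i → L-lift (E i)) c ⟨
        synd (tabulate (L ∘ lift ∘ E)) c             ≡⟨ synd-natural L L-⊕ (lift ∘ E) c ⟩
        L (synd (tabulate (lift ∘ E)) c)             ≡⟨ cong L (ext⇒word c c∈) ⟩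
        L vzero                                      ≡⟨ ⊕-idempotent (trans (sym (L-⊕ vzero vzero)) (cong L (⊕-same vzero))) ⟩
        vzero                                        ∎)
        where open ≡-Reasoning

      -- The automorphism is tested on the sum of the unit words at the four points, whose syndrome
      -- is the sum of their columns.
      aut⇒preservesPlanes : Aut σ → PreservesPlanes act⁻¹
      aut⇒preservesPlanes (_ , σ-aut) x y z w plane = begin
        (lift (act⁻¹ x) ⊕ lift (act⁻¹ y)) ⊕ (lift (act⁻¹ z) ⊕ lift (act⁻¹ w))
          ≡⟨ cong₂ _⊕_ (cong₂ _⊕_ (at x) (at y)) (cong₂ _⊕_ (at z) (at w)) ⟨
        (h (E⁻¹ x) ⊕ h (E⁻¹ y)) ⊕ (h (E⁻¹ z) ⊕ h (E⁻¹ w))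
          ≡⟨ synd-units h (E⁻¹ x) (E⁻¹ y) (E⁻¹ z) (E⁻¹ w) ⟨
        synd (tabulate h) c
          ≡⟨ syndrome-permute c ⟨
        synd (tabulate (lift ∘ E)) (permute σ c)
          ≡⟨ ext⇒word _ (σ-aut c (word⇒ext c c-word)) ⟩
        vzero ∎
        where
        open ≡-Reasoning
        h : Fin (suc n) → BVec (suc (suc k))
        h = lift ∘ act⁻¹ ∘ E
        at : ∀ x → h (E⁻¹ x) ≡ lift (act⁻¹ x)
        at x = cong (lift ∘ act⁻¹) (E∘E⁻¹ x)
        c = (unit (E⁻¹ x) ⊕ unit (E⁻¹ y)) ⊕ (unit (E⁻¹ z) ⊕ unit (E⁻¹ w))
        lift-E : ∀ x → lift (E (E⁻¹ x)) ≡ lift x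
        lift-E x = cong lift (E∘E⁻¹ x)
        c-word : Word c
        c-word = trans (synd-units (lift ∘ E) (E⁻¹ x) (E⁻¹ y) (E⁻¹ z) (E⁻¹ w))
          (trans (cong₂ _⊕_ (cong₂ _⊕_ (lift-E x) (lift-E y)) (cong₂ _⊕_ (lift-E z) (lift-E w))) plane)

    aut⇒affineIsometry : ∀ {σ} → Aut σ → AffineIsometry (act σ)
    aut⇒affineIsometry {σ} σ∈@(σ-inj , _) = inverse-affineIsometry (act⁻¹∘act σ σ-inj)
      (preservesPlanes⇒affineIsometry common⊥ (act⁻¹∘act σ σ-inj) (act∘act⁻¹ σ σ-inj)
        (aut⇒preservesPlanes σ σ-inj σ∈))

    perm-aut : ∀ {g} → AffineIsometry g → Aut (perm g)
    perm-aut {g} G = affineIsometry⇒aut (perm g) (perm-IsPerm g (AffineIsometry.affine-injective G))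
      (AffineIsometry-cong (λ x → sym (act-perm g x)) G)

    translation : BVec k → Perm (suc n)
    translation b = perm (_⊕ b)

    act-translation : ∀ b x → act (translation b) x ≡ x ⊕ b
    act-translation b = act-perm (_⊕ b)

    translation-vzero : translation vzero ≡ idₚ
    translation-vzero = act-injective λ x →
      trans (act-translation vzero x) (trans (⊕-identityʳ x) (sym (act-idₚ x)))

    translation-∘ₚ : ∀ a b → translation (a ⊕ b) ≡ translation a ∘ₚ translation b
    translation-∘ₚ a b = act-injective λ x → begin
      act (translation (a ⊕ b)) x                   ≡⟨ act-translation (a ⊕ b) x ⟩
      x ⊕ (a ⊕ b)                                   ≡⟨ ⊕-solve (x ∷ a ∷ b ∷ []) (# 0F ⊞ (# 1F ⊞ # 2F)) ((# 0F ⊞ # 2F) ⊞ # 1F) refl ⟩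
      (x ⊕ b) ⊕ a                                   ≡⟨ act-translation a (x ⊕ b) ⟨
      act (translation a) (x ⊕ b)                   ≡⟨ cong (act (translation a)) (act-translation b x) ⟨
      act (translation a) (act (translation b) x)   ≡⟨ act-∘ₚ (translation a) (translation b) x ⟨
      act (translation a ∘ₚ translation b) x        ∎
      where open ≡-Reasoning

    translation-aut : ∀ b → Aut (translation b)
    translation-aut b = perm-aut record
      { linear = λ x → x ; translation = b
      ; isometry = record { additive = λ _ _ → refl ; preserves = λ _ _ → refl }
      ; affine = λ _ → refl }

    translation-fixes : ∀ b → lookup (translation b) zero ≡ zero → b ≡ vzero
    translation-fixes b fixes = trans (sym (⊕-identityˡ b))
      (trans (sym (act-translation b vzero)) (act-vzero (translation b) fixes))

    Translation : Perm (suc n) → Set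
    Translation σ = ∃ λ b → σ ≡ translation b

    -- Conjugation by an affine map turns the translation by b into the translation by the image of
    -- b under the linear part.
    translation-normal : ∀ g x → Aut g → Translation x → ∃ λ y → Translation y × (g ∘ₚ x ≡ y ∘ₚ g)
    translation-normal g _ g∈ (b , refl) = translation (linear b) , (linear b , refl) , act-injective λ x → begin
      act (g ∘ₚ translation b) x                ≡⟨ act-∘ₚ g (translation b) x ⟩
      act g (act (translation b) x)             ≡⟨ cong (act g) (act-translation b x) ⟩
      act g (x ⊕ b)                             ≡⟨ affine (x ⊕ b) ⟩
      linear (x ⊕ b) ⊕ t                        ≡⟨ cong (_⊕ t) (additive x b) ⟩
      (linear x ⊕ linear b) ⊕ t                 ≡⟨ ⊕-solve (linear x ∷ linear b ∷ t ∷ [])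
                                                    (# 0F ⊞ # 1F ⊞ # 2F) (# 0F ⊞ # 2F ⊞ # 1F) refl ⟩
      (linear x ⊕ t) ⊕ linear b                 ≡⟨ cong (_⊕ linear b) (affine x) ⟨
      act g x ⊕ linear b                        ≡⟨ act-translation (linear b) (act g x) ⟨
      act (translation (linear b)) (act g x)    ≡⟨ act-∘ₚ (translation (linear b)) g x ⟨
      act (translation (linear b) ∘ₚ g) x       ∎
      where
      open ≡-Reasoning
      open AffineIsometry (aut⇒affineIsometry g∈) renaming (translation to t)

    decompose : ∀ g → Aut g → ∃ λ x → ∃ λ h → Translation x × Stabiliser C h × (g ≡ x ∘ₚ h)
    decompose g g∈ = translation t , h , (t , refl) ,
      (IsAut-∘ₚ (translation t) g (translation-aut t) g∈ , act-vzero⁻ h (trans (act-h vzero) (⊕-same t))) ,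
      act-injective λ x → begin
        act g x                                ≡⟨ ⊕-twice (act g x) t ⟨
        (act g x ⊕ t) ⊕ t                      ≡⟨ cong (_⊕ t) (act-h x) ⟨
        act h x ⊕ t                            ≡⟨ act-translation t (act h x) ⟨
        act (translation t) (act h x)          ≡⟨ act-∘ₚ (translation t) h x ⟨
        act (translation t ∘ₚ h) x             ∎
      where
      open ≡-Reasoning
      -- In characteristic 2 a translation is its own inverse, so the same t both moves the image of
      -- 0 back to 0 and restores g.
      t = act g vzero
      h = translation t ∘ₚ g
      act-h : ∀ x → act h x ≡ act g x ⊕ t
      act-h x = trans (act-∘ₚ (translation t) g x) (act-translation t (act g x))

    semidirect : SemidirectF2 Aut (IsAut C) k
    semidirect = record
      { H      = Stabiliser C
      ; N      = Translation
      ; H-sub  = (λ _ → proj₁) , (IsAut-idₚ , Vec.lookup-allFin zero) ,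
          λ σ τ (σ∈ , σ0) (τ∈ , τ0) → IsAut-∘ₚ σ τ σ∈ τ∈ ,
            trans (lookup-∘ₚ σ τ zero) (trans (cong (lookup σ) τ0) σ0)
      ; N-sub  = (λ { _ (b , refl) → translation-aut b }) , (vzero , sym translation-vzero) ,
          λ { _ _ (a , refl) (b , refl) → a ⊕ b , sym (translation-∘ₚ a b) }
      ; N-norm = translation-normal
      ; meet   = λ { _ (b , refl) (_ , fixes) →
          trans (cong translation (translation-fixes b fixes)) translation-vzero }
      ; prod   = decompose
      ; H≅K    = stabiliser≅ C
      ; N≅F₂ᵐ  = record
        { f    = translation
        ; pres = λ b _ → b , refl
        ; hom  = λ a b _ _ → translation-∘ₚ a b
        ; inj  = λ a b _ _ eq → trans (sym (⊕-identityˡ a)) (trans (sym (act-translation a vzero))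
            (trans (cong (λ σ → act σ vzero) eq) (trans (act-translation b vzero) (⊕-identityˡ b))))
        ; surj = λ { _ (b , refl) → b , tt , refl }
        }
      }

    module Order (j : ℕ) (k≡ : k ≡ j * 2) (n≡ : suc n ≡ 2 ^ k) where
      open HyperbolicSequences S

      vectors : List (BVec k)
      vectors = List.tabulate E

      ∈-vectors : ∀ x → x ∈ vectors
      ∈-vectors x = subst (_∈ vectors) (E∘E⁻¹ x) (∈-tabulate⁺ {f = E} (E⁻¹ x))

      vectors-unique : Unique vectors
      vectors-unique = Unique.tabulate⁺ {f = E} (E-injective _ _)

      vectors-length : length vectors ≡ 2 ^ k
      vectors-length = trans (List.length-tabulate E) n≡

      vectors-dimension : Dimension vectors (j * 2)
      vectors-dimension = record
        { subspace = record { vzero∈ = ∈-vectors vzero ; ⊕-∈ = λ _ _ → ∈-vectors _ }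
        ; unique   = vectors-unique
        ; size     = trans vectors-length (cong (2 ^_) k≡) }

      bases : List (Pairs j)
      bases = sequences j vectors

      bases-length : length bases ≡ ordProd k
      bases-length = trans (sequences-length j vectors-dimension
          (λ x _ x≢0 → let y , xy = nondegenerate x x≢0 in y , ∈-vectors y , xy))
        (cong ordProd (sym k≡))

      -- No basis is constructed by hand: the list of hyperbolic sequences has positive length, so
      -- its first entry serves as the reference.
      basis : ∃ λ (e : Pairs j) → e ∈ bases
      basis = nonempty bases (subst (0 <_) (trans (cong ordProd (sym k≡)) (sym bases-length)) (ordProd>0 j))
        where
        nonempty : ∀ (L : List (Pairs j)) → 0 < length L → ∃ λ e → e ∈ L
        nonempty (e ∷ _) _ = e , here refl

      e : Pairs j
      e = proj₁ basis

      e-hyperbolic : Hyperbolic vectors e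
      e-hyperbolic = ∈-sequences⁻ j (proj₂ basis)

      affineMap : Pairs j → BVec k → BVec k → BVec k
      affineMap s b x = extend e s x ⊕ b

      affineMap-vzero : ∀ s b → affineMap s b vzero ≡ b
      affineMap-vzero s b = trans (cong (_⊕ b) (⊕-idempotent
          (trans (sym (extend-additive e s vzero vzero)) (cong (extend e s) (⊕-same vzero)))))
        (⊕-identityˡ b)

      act-≡ : ∀ {s s′ b b′} → perm (affineMap s b) ≡ perm (affineMap s′ b′) →
              ∀ x → affineMap s b x ≡ affineMap s′ b′ x
      act-≡ eq x = trans (sym (act-perm _ x)) (trans (cong (λ σ → act σ x) eq) (act-perm _ x))

      affineMap-injectiveʳ : ∀ {s s′ b b′} → perm (affineMap s b) ≡ perm (affineMap s′ b′) → b ≡ b′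
      affineMap-injectiveʳ {s} {s′} {b} {b′} eq =
        trans (sym (affineMap-vzero s b)) (trans (act-≡ eq vzero) (affineMap-vzero s′ b′))

      -- The translation part is the image of 0; once it is cancelled, the sequence is recovered as
      -- the image of the fixed basis `e`.
      affineMap-injectiveˡ : ∀ {s s′ b b′} → perm (affineMap s b) ≡ perm (affineMap s′ b′) → s ≡ s′
      affineMap-injectiveˡ {s} {s′} {b} eq with affineMap-injectiveʳ {s} {s′} eq
      ... | refl = trans (sym (extend-basis e s e-hyperbolic))
        (trans (mapPairs-cong e e-hyperbolic (λ {x} _ → ⊕-cancelʳ b (act-≡ {s} {s′} eq x)))
               (extend-basis e s′ e-hyperbolic))

      withBasis : Pairs j → List (Perm (suc n))
      withBasis s = List.map (perm ∘ affineMap s) vectors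

      automorphisms : List (Perm (suc n))
      automorphisms = concatMap withBasis bases

      automorphisms-sound : ∀ σ → σ ∈ automorphisms → Aut σ
      automorphisms-sound σ σ∈ with find (∈-concatMap⁻ withBasis {xs = bases} σ∈)
      ... | s , s∈ , σ∈′ with ∈-map⁻ (perm ∘ affineMap s) σ∈′
      ...   | b , _ , refl = perm-aut record
        { linear = extend e s ; translation = b
        ; isometry = extend-isometry e s vectors-dimension ∈-vectors e-hyperbolic (∈-sequences⁻ j s∈)
        ; affine = λ _ → refl }

      automorphisms-complete : ∀ σ → Aut σ → σ ∈ automorphisms
      automorphisms-complete σ σ-aut = ∈-concatMap⁺ withBasis {xs = bases}
        (lose (∈-sequences⁺ s (hyperbolic-map e isometry (λ _ → ∈-vectors _) e-hyperbolic))
              (subst (_∈ withBasis s) (sym σ≡) (∈-map⁺ (perm ∘ affineMap s) (∈-vectors t))))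
        where
        open AffineIsometry (aut⇒affineIsometry σ-aut) renaming (translation to t)
        s = mapPairs linear e
        σ≡ : σ ≡ perm (affineMap s t)
        σ≡ = act-injective λ x → trans (affine x) (trans
          (cong (_⊕ t) (sym (isometry-extend e vectors-dimension ∈-vectors e-hyperbolic isometry x)))
          (sym (act-perm (affineMap s t) x)))

      automorphisms-unique : Unique automorphisms
      automorphisms-unique = unique-concatMap (sequences-unique j vectors-unique)
        (λ s _ → Unique.map⁺ (affineMap-injectiveʳ {s} {s}) vectors-unique)
        (λ σ∈ σ∈′ → same-basis (∈-map⁻ _ σ∈) (∈-map⁻ _ σ∈′))
        where
        same-basis : ∀ {s s′ σ} → (∃ λ b → b ∈ vectors × σ ≡ perm (affineMap s b)) →
                     (∃ λ b → b ∈ vectors × σ ≡ perm (affineMap s′ b)) → s ≡ s′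
        same-basis (_ , _ , eq) (_ , _ , eq′) = affineMap-injectiveˡ (trans (sym eq) eq′)

      order : HasOrder Aut (ordProd k * 2 ^ k)
      order = automorphisms , automorphisms-unique , automorphisms-sound , automorphisms-complete ,
        trans (length-concatMap withBasis (2 ^ k) bases
                (λ s _ → trans (List.length-map (perm ∘ affineMap s) vectors) vectors-length))
              (cong (_* 2 ^ k) bases-length)

-- Two linear conditions have at most four value patterns, so among more
-- than four vectors two agree on both.
common-perpendicular : ∀ {k N} (S : SymplecticForm k) → let open SymplecticForm S in 4 < N →
  (E : Fin N → BVec k) → (∀ i j → E i ≡ E j → i ≡ j) →
  ∀ x y → ∃ λ z → z ≢ vzero × B z x ≡ false × B z y ≡ false
common-perpendicular S 4<N E E-inj x y
  with Fin.pigeonhole 4<N (λ i → encode (SymplecticForm.B S (E i) x ∷ SymplecticForm.B S (E i) y ∷ []))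
... | i , j , i<j , eq = E i ⊕ E j ,
  (λ z≡0 → Fin.<⇒≢ i<j (E-inj i j (⊕-cancel z≡0))) ,
  agree⇒⊥ x (cong head values≡) , agree⇒⊥ y (cong (head ∘ tail) values≡)
  where
  open SymplecticForm S
  values≡ : B (E i) x ∷ B (E i) y ∷ [] ≡ B (E j) x ∷ B (E j) y ∷ []
  values≡ = encode-injective _ _ eq
  agree⇒⊥ : ∀ w → B (E i) w ≡ B (E j) w → B (E i ⊕ E j) w ≡ false
  agree⇒⊥ w eq = trans (B-⊕ˡ (E i) (E j) w) (trans (cong (_xor B (E j) w) eq) (Bool.xor-same (B (E j) w)))

-- The extended code as the relations among lifted points

synd-lift : ∀ {k l} (Q : BVec k → Bool) (hs : Vec (BVec k) l) c →
  synd (map (λ h → true ∷ Q h ∷ h) hs) c ≡ parity c ∷ dot (map Q hs) c ∷ synd hs c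
synd-lift Q []       []          = refl
synd-lift Q (h ∷ hs) (true  ∷ c) = trans (cong ((true ∷ Q h ∷ h) ⊕_) (synd-lift Q hs c))
  (cong (λ q → _ ∷ (q xor _) ∷ _) (sym (Bool.∧-identityʳ (Q h))))
synd-lift Q (h ∷ hs) (false ∷ c) = trans (cong (vzero ⊕_) (synd-lift Q hs c))
  (cong (λ q → _ ∷ (q xor _) ∷ _) (sym (Bool.∧-zeroʳ (Q h))))

module ExtendedCode (j : ℕ) (p : BVec (suc j * 2)) (prim : IsPrimitive p) (i₁ i₂ : Fin 4)
  (Q : BVec (suc j * 2) → Bool) (Q-vzero : Q vzero ≡ false) (Q-indicator : ∀ x → Q x ≡ indicator i₁ i₂ x) where

  open Powers p prim

  enumeration : Enumeration (suc j * 2) (2 ^ (suc j * 2) ∸ 1)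
  enumeration = record { E = E ; E-zero = refl ; E-injective = E-injective ; E-surjective = E-surjective }

  lift : BVec (suc j * 2) → BVec (suc (suc (suc j * 2)))
  lift x = true ∷ Q x ∷ x

  -- Since Q vanishes at 0, the column at ∞ is (1, 0, 0) and x enters the first entry alone. That
  -- entry is the condition on c_∞, and the other two are the parity checks of C.
  syndrome : ∀ x c → synd (tabulate (lift ∘ E)) (x ∷ c) ≡
                     (x xor parity c) ∷ dot (vRow p i₁ i₂) c ∷ synd (HMat p) c
  syndrome x c = trans (cong₂ _⊕_ (at-∞ x)
      (trans (cong (λ hs → synd hs c) (Vec.tabulate-∘ lift (alphaPow p ∘ toℕ)))
             (synd-lift Q (HMat p) c)))
    (cong₂ (λ d s → (x xor parity c) ∷ d ∷ s)
      (cong (λ v → dot v c) (Vec.map-cong Q-indicator (HMat p))) (⊕-identityˡ _))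
    where
    at-∞ : ∀ x → x · lift vzero ≡ x ∷ false ∷ vzero
    at-∞ true  = cong (λ q → true ∷ q ∷ vzero) Q-vzero
    at-∞ false = refl

  ext⇒word : ∀ c → Ext (InC p i₁ i₂) c → synd (tabulate (lift ∘ E)) c ≡ vzero
  ext⇒word (_ ∷ c) ((s≡0 , d≡0) , refl) = trans (syndrome (parity c) c)
    (trans (cong₂ (λ d s → (parity c xor parity c) ∷ d ∷ s) d≡0 s≡0)
           (cong (_∷ vzero) (Bool.xor-same (parity c))))

  word⇒ext : ∀ c → synd (tabulate (lift ∘ E)) c ≡ vzero → Ext (InC p i₁ i₂) c
  word⇒ext (x ∷ c) eq with Vec.∷-injective (trans (sym (syndrome x c)) eq)
  ... | x+c≡0 , eq′ with Vec.∷-injective eq′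
  ...   | d≡0 , s≡0 = (s≡0 , d≡0) , xor-cancel x (parity c) x+c≡0
    where
    xor-cancel : ∀ a b → a xor b ≡ false → a ≡ b
    xor-cancel true  true  _ = refl
    xor-cancel false false _ = refl

theorem2p6 : (m : ℕ) (p : BVec m) (i₁ i₂ : Fin 4) →
    4 ≤ m → m % 2 ≡ 0 → IsPrimitive p →
    (toℕ i₁ + toℕ i₂) % 2 ≡ 1 → toℕ i₁ ≢ 0 → toℕ i₂ ≢ 0 →
    SemidirectF2 (IsAut (Ext (InC p i₁ i₂))) (IsAut (InC p i₁ i₂)) m
    × HasOrder (IsAut (Ext (InC p i₁ i₂))) (ordProd m * 2 ^ m)
theorem2p6 m p i₁ i₂ 4≤m m-even prim odd i₁≢0 i₂≢0 with m%n≡0⇒n∣m m 2 m-even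
theorem2p6 _ p i₁ i₂ () _ _ _ _ _ | divides zero refl
theorem2p6 _ p i₁ i₂ 4≤m _ prim odd i₁≢0 i₂≢0 | divides (suc j) refl =
  semidirect , Order.order (suc j) refl 1+n≡2^m
  where
  form = indicatorForm (suc j) i₁ i₂ odd i₁≢0 i₂≢0
  F = proj₁ form
  open Powers p prim
  open ExtendedCode j p prim i₁ i₂ (QuadraticForm.Q F) (QuadraticForm.Q-vzero F) (proj₂ form)
  4<1+n : 4 < suc (2 ^ (suc j * 2) ∸ 1)
  -- The constants say 5 ≤ 5 + 11 = 2⁴, and 2⁴ ≤ 2ᵐ because m ≥ 4.
  4<1+n = subst (4 <_) (sym 1+n≡2^m) (ℕ.≤-trans (ℕ.m≤m+n 5 11) (ℕ.^-monoʳ-≤ 2 4≤m))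
  open AutomorphismGroup F enumeration (InC p i₁ i₂)
  open Characterisation (common-perpendicular (polarForm (suc j)) 4<1+n E E-injective) ext⇒word word⇒ext
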